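{- For every prime power $q > 2$, Homma's constant satisfies $D(q) \ge 1$.
   Context: Let $q$ be a prime power and $\mathbb{F}_q$ the finite field with $q$ elements. For a positive integer $d$, let $M_q(d)$ denote the maximum of $|\mathcal{X}(\mathbb{F}_q)|$ (the number of $\mathbb{F}_q$-rational points) taken over all irreducible projective curves $\mathcal{X}$ of degree $d$ defined over $\mathbb{F}_q$ lying in a projective space $\mathbb{P}^n$ over $\mathbb{F}_q$ of any dimension $n$ (the dimension is not fixed; the curves need not be nonsingular). Homma's constant is $D(q) := \limsup_{d\to\infty} M_q(d)/d$. -}

module Defs where

open import Level using (0ℓ; Lift; lift)
open import Algebra.Bundles using (CommutativeRing; Semiring)
import Algebra.Definitions.RawMonoid as RawMonoid
import Algebra.Definitions.RawSemiring as RawSemiring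
open import Data.Bool.Base using (if_then_else_)
open import Data.Fin.Base using (Fin)
open import Data.Integer.Base as ℤ using (ℤ; +_)
import Data.Integer.Properties as ℤ
open import Data.List.Base as List using (List; []; _∷_; _++_; concat; cartesianProductWith; filter)
open import Data.Nat.Base as ℕ using (ℕ; suc)
open import Data.Nat.Primality using (Prime)
import Data.Nat.Coprimality as Coprime
import Data.Nat.Properties as ℕ
open import Data.Product.Base using (Σ; ∃; ∃₂; _×_; _,_; proj₂; map₁; zip)
open import Data.Rational.Base as ℚ using (ℚ; 1ℚ; 1/_)
import Data.Rational.Properties as ℚ
open import Data.Sum.Base using (_⊎_)
open import Data.Vec.Base as Vec using (Vec; lookup; zipWith)
open import Data.Vec.Properties using (≡-dec)
open import Function.Bundles using (Bijection; _⇔_; mk⇔)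
open import Relation.Binary.Bundles using (Setoid)
open import Relation.Binary.PropositionalEquality as ≡ using (_≡_; _≢_)
open import Relation.Nullary using (¬_; does)

IsPrimePower : ℕ → Set
IsPrimePower q = ∃₂ λ p k → Prime p × q ≡ p ℕ.^ suc k

HasCardinality : ∀ {a ℓ} → Setoid a ℓ → ℕ → Set _
HasCardinality S k = Bijection (≡.setoid (Fin k)) S

record Field : Set₁ where
  field
    commutativeRing : CommutativeRing 0ℓ 0ℓ
  open CommutativeRing commutativeRing public
  field
    1≉0     : ¬ (1# ≈ 0#)
    inverse : ∀ x → ¬ (x ≈ 0#) → ∃ λ y → x * y ≈ 1#

-- An extended real α in [-∞, +∞] is represented by the set of rationals c < α.
-- Cuts take values in Set₁ because suprema over all curves are needed.

record LowerReal : Set₂ where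
  infix 4 _below
  field
    _below  : ℚ → Set₁
    down    : ∀ {b c} → b ℚ.< c → c below → b below
    rounded : ∀ {c} → c below → ∃ λ e → c ℚ.< e × e below

open LowerReal public

infix 4 _≤ᴸ_

_≤ᴸ_ : LowerReal → LowerReal → Set₁
α ≤ᴸ β = ∀ c → (α below) c → (β below) c

fromℚ : ℚ → LowerReal
fromℚ a = record
  { _below  = λ c → Lift _ (c ℚ.< a)
  ; down    = λ { b<c (lift c<a) → lift (ℚ.<-trans b<c c<a) }
  ; rounded = λ { (lift c<a) → let e , c<e , e<a = ℚ.<-dense c<a
                                     in e , c<e , lift e<a }
  }

ℕ→ℚ : ℕ → ℚ
ℕ→ℚ n = ℚ.mkℚ (+ n) 0 (Coprime.sym (Coprime.1-coprimeTo n))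

IsMaximum : (ℕ → Set₁) → ℕ → Set₁
IsMaximum S m = S m × (∀ k → S k → k ℕ.≤ m)

-- The supremum of a set of natural numbers. It is used for maxima: unlike the
-- maximum, it is available without first proving that one exists, and
-- it agrees with the maximum as soon as there is one (sup-maximum below).

sup : (ℕ → Set₁) → LowerReal
sup S = record
  { _below  = λ c → ∃ λ k → S k × c ℚ.< ℕ→ℚ k
  ; down    = λ { b<c (k , s , c<k) → k , s , ℚ.<-trans b<c c<k }
  ; rounded = λ { (k , s , c<k) → let e , c<e , e<k = ℚ.<-dense c<k
                                  in e , c<e , k , s , e<k }
  }

private
  ℕ→ℚ-mono : ∀ {k m} → k ℕ.≤ m → ℕ→ℚ k ℚ.≤ ℕ→ℚ m
  ℕ→ℚ-mono k≤m = ℚ.*≤* (ℤ.*-monoʳ-≤-nonNeg (+ 1) (ℤ.+≤+ k≤m))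

sup-maximum : ∀ {S m} → IsMaximum S m →
              ∀ c → (sup S below) c ⇔ (fromℚ (ℕ→ℚ m) below) c
sup-maximum {S} {m} (Sm , ub) c = mk⇔
  (λ { (k , Sk , c<k) → lift (ℚ.<-≤-trans c<k (ℕ→ℚ-mono (ub k Sk))) })
  (λ { (lift c<m) → m , Sm , c<m })

infixl 7 _/ᴸ_

_/ᴸ_ : LowerReal → (d : ℕ) → .{{ℕ.NonZero d}} → LowerReal
α /ᴸ suc n = record
  { _below  = λ c → (α below) (c ℚ.* d)
  ; down    = λ b<c → down α (ℚ.*-monoˡ-<-pos d b<c)
  ; rounded = λ {c} cd<α → let e , cd<e , e<α = rounded α cd<α in
      e ℚ.* 1/ d
    , ℚ.*-cancelʳ-<-nonNeg d (≡.subst (c ℚ.* d ℚ.<_) (≡.sym (cancel e)) cd<e)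
    , ≡.subst (α below) (≡.sym (cancel e)) e<α
  }
  where
  d = ℕ→ℚ (suc n)
  cancel : ∀ e → e ℚ.* 1/ d ℚ.* d ≡ e
  cancel e = ≡.trans (ℚ.*-assoc e (1/ d) d)
            (≡.trans (≡.cong (e ℚ.*_) (ℚ.*-inverseˡ d)) (ℚ.*-identityʳ e))

-- c < limsup a  iff  some e > c satisfies e < a n for infinitely many n.

limsup : (ℕ → LowerReal) → LowerReal
limsup a = record
  { _below  = λ c → ∃ λ e → c ℚ.< e × (∀ N → ∃ λ n → N ℕ.≤ n × (a n below) e)
  ; down    = λ { b<c (e , c<e , often) → e , ℚ.<-trans b<c c<e , often }
  ; rounded = λ { (e , c<e , often) → let e′ , c<e′ , e′<e = ℚ.<-dense c<e
                                      in e′ , c<e′ , e , e′<e , often }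
  }

module Curves (F : Field) where

  open Field F
  open RawMonoid *-rawMonoid using () renaming (sum to product)
  open RawSemiring (Semiring.rawSemiring semiring) using (_^_)

  -- A polynomial in v variables is a list of terms, each a coefficient with an
  -- exponent vector. Exponents may repeat, so equality is equality of coeff.

  Exponent : ℕ → Set
  Exponent v = Vec ℕ v

  Poly : ℕ → Set
  Poly v = List (Carrier × Exponent v)

  module _ {v : ℕ} where

    coeff : Poly v → Exponent v → Carrier
    coeff []             e  = 0#
    coeff ((c , e′) ∷ f) e = if does (≡-dec ℕ._≟_ e′ e) then c + coeff f e else coeff f e

    infix 4 _≋_

    _≋_ : Poly v → Poly v → Set
    f ≋ g = ∀ e → coeff f e ≈ coeff g e

    0ₚ 1ₚ : Poly v
    0ₚ = []
    1ₚ = (1# , Vec.replicate v 0) ∷ []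

    infixl 6 _+ₚ_ _-ₚ_
    infixl 7 _*ₚ_
    infixr 7 _·ₚ_

    _+ₚ_ _-ₚ_ _*ₚ_ : Poly v → Poly v → Poly v
    f +ₚ g = f ++ g
    f -ₚ g = f ++ List.map (map₁ (λ c → - c)) g
    _*ₚ_   = cartesianProductWith (zip _*_ (zipWith ℕ._+_))

    _·ₚ_ : Carrier → Poly v → Poly v
    a ·ₚ f = List.map (map₁ (a *_)) f

    linComb : ∀ {k} → (Fin k → Carrier) → (Fin k → Poly v) → Poly v
    linComb a b = concat (List.tabulate λ i → a i ·ₚ b i)

    eval : Poly v → (Fin v → Carrier) → Carrier
    eval []            x = 0#
    eval ((c , e) ∷ f) x = c * product (λ i → x i ^ lookup e i) + eval f x

    Homogeneous : ℕ → Poly v → Set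
    Homogeneous m f = ∀ e → Vec.sum e ≢ m → coeff f e ≈ 0#

    component : ℕ → Poly v → Poly v
    component m = filter λ t → Vec.sum (proj₂ t) ℕ.≟ m

    record IsIdeal (I : Poly v → Set) : Set where
      field
        resp     : ∀ {f g} → f ≋ g → I f → I g
        0-closed : I 0ₚ
        +-closed : ∀ {f g} → I f → I g → I (f +ₚ g)
        *-closed : ∀ f {g} → I g → I (f *ₚ g)

    record IsHomogeneousPrime (I : Poly v → Set) : Set where
      field
        isIdeal     : IsIdeal I
        homogeneous : ∀ {f} → I f → ∀ m → I (component m f)
        proper      : ¬ I 1ₚ
        prime       : ∀ f g → I (f *ₚ g) → I f ⊎ I g

    -- dim (S/I)ₘ = k, where S is the polynomial ring: there are k forms of
    -- degree m whose classes are a basis of (S/I)ₘ.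

    HilbertFunction : (Poly v → Set) → ℕ → ℕ → Set
    HilbertFunction I m k = Σ (Fin k → Poly v) λ b →
        (∀ i → Homogeneous m (b i))
      × (∀ f → Homogeneous m f → ∃ λ a → I (f -ₚ linComb a b))
      × (∀ a → I (linComb a b) → ∀ i → a i ≈ 0#)

  -- A curve in ℙⁿ, irreducible over F, given by its homogeneous prime ideal.
  -- It has dimension 1 and degree d when its Hilbert polynomial is d t + c
  -- with d > 0.

  record IrreducibleCurve : Set₁ where
    field
      n                  : ℕ
      ideal              : Poly (suc n) → Set
      isHomogeneousPrime : IsHomogeneousPrime ideal
      degree             : ℕ
      degree>0           : 0 ℕ.< degree
      hilbertPolynomial  : ∃₂ λ (c : ℤ) m₀ → ∀ m → m₀ ℕ.≤ m →
        ∃ λ k → HilbertFunction ideal m k × + k ≡ + degree ℤ.* + m ℤ.+ c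

  module _ (X : IrreducibleCurve) where
    open IrreducibleCurve X

    record RationalPoint : Set where
      field
        coord    : Fin (suc n) → Carrier
        nonzero  : ∃ λ i → ¬ (coord i ≈ 0#)
        vanishes : ∀ f → ideal f → eval f coord ≈ 0#

    open RationalPoint

    infix 4 _∼_

    _∼_ : RationalPoint → RationalPoint → Set
    x ∼ y = ∃ λ s → ¬ (s ≈ 0#) × (∀ i → coord x i ≈ s * coord y i)

    private
      unit≉0 : ∀ {s t} → s * t ≈ 1# → ¬ (t ≈ 0#)
      unit≉0 {s} st≈1 t≈0 = 1≉0 (trans (sym st≈1) (trans (*-congˡ t≈0) (zeroʳ s)))

      *-≉0 : ∀ {s t} → ¬ (s ≈ 0#) → ¬ (t ≈ 0#) → ¬ (s * t ≈ 0#)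
      *-≉0 {s} {t} s≉0 t≉0 st≈0 = let r , sr≈1 = inverse s s≉0 in
        t≉0 (trans (sym (*-identityˡ t))
            (trans (*-congʳ (trans (sym sr≈1) (*-comm s r)))
            (trans (*-assoc r s t) (trans (*-congˡ st≈0) (zeroʳ r)))))

    points : Setoid 0ℓ 0ℓ
    points = record
      { Carrier       = RationalPoint
      ; _≈_           = _∼_
      ; isEquivalence = record
        { refl  = 1# , 1≉0 , λ i → sym (*-identityˡ _)
        ; sym   = λ { (s , s≉0 , x≈sy) → let r , sr≈1 = inverse s s≉0 in
                      r , unit≉0 sr≈1 , λ i →
                      trans (sym (*-identityˡ _))
                      (trans (*-congʳ (trans (sym sr≈1) (*-comm s r)))
                      (trans (*-assoc r s _) (*-congˡ (sym (x≈sy i))))) }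
        ; trans = λ { (s , s≉0 , x≈sy) (t , t≉0 , y≈tz) →
                      s * t , *-≉0 s≉0 t≉0 , λ i →
                      trans (x≈sy i)
                      (trans (*-congˡ (y≈tz i)) (sym (*-assoc s t _))) }
        }
      }

  PointCount : ℕ → ℕ → Set₁
  PointCount d k = Σ IrreducibleCurve λ X →
    IrreducibleCurve.degree X ≡ d × HasCardinality (points X) k

  -- The maximal number of rational points on irreducible curves of degree d.

  M : ℕ → LowerReal
  M d = sup (PointCount d)

  -- The index is shifted so that d = suc n runs over the positive integers.

  D : LowerReal
  D = limsup λ n → M (suc n) /ᴸ suc n

{-# OPTIONS --safe #-}
module Submission where

-- Write q = p + 1, and consider in ℙⁿ⁺¹, with coordinates (z : y₀ : … : yₙ), the curve
--   yⱼ^q = yⱼ yₙ^p + z^p yⱼ₊₁   (0 ≤ j < n).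
-- Its section by z = 0 consists of the qⁿ rational points (0 : a₀ : … : aₙ₋₁ : 1), because
-- a^q = a in F, and (1 : 0 : … : 0) is the only other rational point. The equations rewrite
-- every form into monomials with all of y₀, …, yₙ₋₁ to exponents below q, and counting
-- these monomials gives degree qⁿ. At (1 : 0 : … : 0) the curve is totally ramified over
-- the yₙ-line: with z = 1 it has a branch in F[[X]] with y₀ = X on which yⱼ has order qʲ.
-- So the reduced monomials of a given degree have distinct orders there (base-q digits),
-- hence are linearly independent, and the ideal of the branch is the ideal of the curve;
-- it is prime because F[[X]] is a domain.

open import Defs
open import Data.Nat using (ℕ; _<_)
open import Data.Rational using (1ℚ)

open import Level using (0ℓ; lift)
open import Algebra.Bundles using (CommutativeRing)
import Algebra.Definitions.RawMonoid as RawMonoid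
import Algebra.Morphism.Construct.Identity as Identity
open import Algebra.Morphism.Structures using (IsRingHomomorphism)
import Algebra.Properties.CommutativeMonoid.Sum as CommutativeMonoidSum
import Algebra.Properties.CommutativeSemigroup as CommutativeSemigroupProperties
import Algebra.Properties.Group as GroupProperties
import Algebra.Properties.Ring as RingProperties
import Algebra.Properties.Semiring.Exp as Exp
import Algebra.Properties.Semiring.Sum as Sum
import Algebra.Solver.Ring.NaturalCoefficients.Default as RingSolver
open import Data.Bool.Base using (true; false)
open import Data.Fin.Base using (Fin; zero; suc; inject₁; fromℕ; finToFun; funToFin; combine)
open import Data.Fin.Induction using (>-weakInduction)
open import Data.Fin.Permutation using (Permutation; permutation)
import Data.Fin.Properties as Fin
open import Data.Integer.Base as ℤ using (ℤ; +_)
import Data.Integer.Properties as ℤ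
open import Data.List.Base as List using (List; []; _∷_; _++_; map; filter; length; upTo)
open import Data.List.Membership.Propositional using (_∈_)
open import Data.List.Membership.Propositional.Properties
  using (∈-lookup; ∈-map⁺; ∈-map⁻; ∈-++⁺ˡ; ∈-++⁺ʳ; ∈-upTo⁺; ∈-upTo⁻)
import Data.List.Properties as List
open import Data.List.Relation.Unary.All as All using (All; []; _∷_)
import Data.List.Relation.Unary.All.Properties as All
open import Data.List.Relation.Unary.AllPairs using ([]; _∷_)
import Data.List.Relation.Unary.Any as Any
import Data.List.Relation.Unary.Any.Properties as Any
open import Data.List.Relation.Unary.Unique.Propositional using (Unique)
import Data.List.Relation.Unary.Unique.Propositional.Properties as Unique
open import Data.Nat.Base as ℕ using (zero; suc; z≤n; s≤s)
open import Data.Nat.DivMod using (_%_; [m+kn]%n≡m%n; m<n⇒m%n≡m)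
open import Data.Nat.Induction using (<-rec)
import Data.Nat.Properties as ℕ
open import Data.Nat.Solver using (module +-*-Solver)
open import Data.Product.Base using (Σ; ∃; ∃₂; _×_; _,_; proj₁; proj₂; map₁; zip)
import Data.Rational.Base as ℚ
import Data.Rational.Properties as ℚ
open import Data.Sum.Base using (_⊎_; inj₁; inj₂)
open import Data.Unit.Base using (⊤; tt)
open import Data.Vec.Base as Vec using (Vec; []; _∷_; lookup; zipWith; replicate)
open import Data.Vec.Functional using (updateAt)
import Data.Vec.Properties as Vec
open import Function.Base using (_∘_; id)
open import Function.Bundles using (module Bijection)
open import Relation.Binary.Bundles using (module Setoid)
open import Relation.Binary.Definitions using (Decidable; DecidableEquality; tri<; tri≈; tri>)
open import Relation.Binary.PropositionalEquality as ≡ using (_≡_; _≢_)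
import Relation.Binary.Reasoning.Setoid as SetoidReasoning
open import Relation.Nullary using (¬_; Dec; yes; no; does; contradiction)
open import Relation.Nullary.Decidable using (¬?; map′)
import Relation.Unary as Unary

-- With wⱼ = yⱼ / yₙ and t = z / yₙ the equations become wⱼ^q - wⱼ = t^p wⱼ₊₁ with wₙ = 1. These are
-- Artin-Schreier equations whose right-hand sides vanish at t = 0, which is why the whole fibre t =
-- 0 is rational. Defining the ideal by a single branch makes primeness accessible, but it leaves
-- open why a form of the ideal vanishes at the rational points with z = 0, where the branch does
-- not pass. For this the rewriting into reduced monomials is carried out at points with values in
-- an arbitrary commutative ring, with coefficients in F chosen before the ring. A form that
-- vanishes on the branch has all these coefficients zero, by independence, and so vanishes at every
-- point over F that satisfies the equations. Primeness is a disjunction and has to be decided.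
-- Hence nonvanishing is carried along as a nonzero coefficient that has been found, and membership
-- in the ideal is reduced to finitely many equalities in F.

module PowerSeries (R : CommutativeRing 0ℓ 0ℓ) where

  open CommutativeRing R hiding (zero)
  open CommutativeSemigroupProperties +-commutativeSemigroup using (interchange)
  open RingProperties ring using (-0#≈0#)
  private module ≈-Reasoning = SetoidReasoning setoid

  -- The ring of formal power series.

  Series : Set
  Series = ℕ → Carrier

  infix 4 _≈ₛ_

  -- A record instead of a bare pointwise statement, so that both series can be inferred from a
  -- proof of their equality.
  record _≈ₛ_ (f g : Series) : Set where
    constructor pointwise
    field at : ∀ n → f n ≈ g n
  open _≈ₛ_ public

  infixl 6 _+ₛ_
  infixl 7 _*ₛ_

  tail : Series → Series
  tail f = f ∘ suc

  constant : Carrier → Series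
  constant a zero    = a
  constant a (suc n) = 0#

  shift : Series → Series
  shift f zero    = 0#
  shift f (suc n) = f n

  0ₛ 1ₛ X : Series
  0ₛ n = 0#
  1ₛ   = constant 1#
  X    = shift 1ₛ

  -- The product splits the left factor as `f 0` plus `X` times `tail f`, so the ring laws follow by
  -- induction on the degree, without sums over pairs of indices.
  _+ₛ_ _*ₛ_ : Series → Series → Series
  (f +ₛ g) n       = f n + g n
  (f *ₛ g) zero    = f 0 * g 0
  (f *ₛ g) (suc n) = f 0 * g (suc n) + (tail f *ₛ g) n

  -ₛ_ : Series → Series
  (-ₛ f) n = - f n

  *ₛ-cong : ∀ {f f′ g g′} → (∀ n → f n ≈ f′ n) → (∀ n → g n ≈ g′ n) → ∀ n → (f *ₛ g) n ≈ (f′ *ₛ g′) n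
  *ₛ-cong f≈ g≈ zero    = *-cong (f≈ 0) (g≈ 0)
  *ₛ-cong f≈ g≈ (suc n) = +-cong (*-cong (f≈ 0) (g≈ (suc n))) (*ₛ-cong (f≈ ∘ suc) g≈ n)

  *ₛ-distribʳ : ∀ h f g n → ((f +ₛ g) *ₛ h) n ≈ (f *ₛ h) n + (g *ₛ h) n
  *ₛ-distribʳ h f g zero    = distribʳ (h 0) (f 0) (g 0)
  *ₛ-distribʳ h f g (suc n) = trans
    (+-cong (distribʳ (h (suc n)) (f 0) (g 0)) (*ₛ-distribʳ h (tail f) (tail g) n))
    (interchange _ _ _ _)

  -- Mirror image of the defining recursion, taking the constant term off the right factor;
  -- commutativity follows from the two together.
  *ₛ-sucʳ : ∀ f g n → (f *ₛ g) (suc n) ≈ (f *ₛ tail g) n + f (suc n) * g 0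
  *ₛ-sucʳ f g zero    = refl
  *ₛ-sucʳ f g (suc n) = trans (+-congˡ (*ₛ-sucʳ (tail f) g n)) (sym (+-assoc _ _ _))

  *ₛ-comm : ∀ f g n → (f *ₛ g) n ≈ (g *ₛ f) n
  *ₛ-comm f g zero    = *-comm (f 0) (g 0)
  *ₛ-comm f g (suc n) = trans (+-cong (*-comm _ _) (*ₛ-comm (tail f) g n))
                       (trans (+-comm _ _) (sym (*ₛ-sucʳ g f n)))

  scale-*ₛ : ∀ a f g n → ((λ k → a * f k) *ₛ g) n ≈ a * (f *ₛ g) n
  scale-*ₛ a f g zero    = *-assoc a (f 0) (g 0)
  scale-*ₛ a f g (suc n) = trans (+-cong (*-assoc _ _ _) (scale-*ₛ a (tail f) g n))
                                 (sym (distribˡ a _ _))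

  *ₛ-assoc : ∀ f g h n → ((f *ₛ g) *ₛ h) n ≈ (f *ₛ (g *ₛ h)) n
  *ₛ-assoc f g h zero    = *-assoc _ _ _
  *ₛ-assoc f g h (suc n) = begin
    f 0 * g 0 * h (suc n) + (((λ k → f 0 * tail g k) +ₛ tail f *ₛ g) *ₛ h) n
      ≈⟨ +-cong (*-assoc _ _ _) (*ₛ-distribʳ h _ (tail f *ₛ g) n) ⟩
    f 0 * (g 0 * h (suc n)) + (((λ k → f 0 * tail g k) *ₛ h) n + ((tail f *ₛ g) *ₛ h) n)
      ≈⟨ +-congˡ (+-cong (scale-*ₛ (f 0) (tail g) h n) (*ₛ-assoc (tail f) g h n)) ⟩
    f 0 * (g 0 * h (suc n)) + (f 0 * (tail g *ₛ h) n + (tail f *ₛ (g *ₛ h)) n)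
      ≈⟨ +-assoc _ _ _ ⟨
    (f 0 * (g 0 * h (suc n)) + f 0 * (tail g *ₛ h) n) + (tail f *ₛ (g *ₛ h)) n
      ≈⟨ +-congʳ (distribˡ (f 0) _ _) ⟨
    f 0 * (g *ₛ h) (suc n) + (tail f *ₛ (g *ₛ h)) n ∎
    where open ≈-Reasoning

  *ₛ-zeroˡ : ∀ f n → (0ₛ *ₛ f) n ≈ 0#
  *ₛ-zeroˡ f zero    = zeroˡ _
  *ₛ-zeroˡ f (suc n) = trans (+-cong (zeroˡ _) (*ₛ-zeroˡ f n)) (+-identityˡ 0#)

  constant-*ₛ : ∀ a f n → (constant a *ₛ f) n ≈ a * f n
  constant-*ₛ a f zero    = refl
  constant-*ₛ a f (suc n) = trans (+-congˡ (*ₛ-zeroˡ f n)) (+-identityʳ _)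

  *ₛ-identityˡ : ∀ f n → (1ₛ *ₛ f) n ≈ f n
  *ₛ-identityˡ f n = trans (constant-*ₛ 1# f n) (*-identityˡ (f n))

  shift-*ₛ : ∀ f g n → (shift f *ₛ g) n ≈ shift (f *ₛ g) n
  shift-*ₛ f g zero    = zeroˡ _
  shift-*ₛ f g (suc n) = trans (+-congʳ (zeroˡ _)) (+-identityˡ _)

  commutativeRing : CommutativeRing 0ℓ 0ℓ
  commutativeRing = record
    { Carrier = Series ; _≈_ = _≈ₛ_ ; _+_ = _+ₛ_ ; _*_ = _*ₛ_ ; -_ = -ₛ_ ; 0# = 0ₛ ; 1# = 1ₛ
    ; isCommutativeRing = record
      { isRing = record
        { +-isAbelianGroup = record
          { isGroup = record
            { isMonoid = record
              { isSemigroup = record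
                { isMagma = record
                  { isEquivalence = record
                    { refl  = pointwise λ n → refl
                    ; sym   = λ p → pointwise λ n → sym (at p n)
                    ; trans = λ p q → pointwise λ n → trans (at p n) (at q n)
                    }
                  ; ∙-cong = λ p q → pointwise λ n → +-cong (at p n) (at q n)
                  }
                ; assoc = λ f g h → pointwise λ n → +-assoc (f n) (g n) (h n)
                }
              ; identity = (λ f → pointwise λ n → +-identityˡ (f n))
                         , (λ f → pointwise λ n → +-identityʳ (f n))
              }
            ; inverse = (λ f → pointwise λ n → -‿inverseˡ (f n))
                      , (λ f → pointwise λ n → -‿inverseʳ (f n))
            ; ⁻¹-cong = λ p → pointwise λ n → -‿cong (at p n)
            }
          ; comm = λ f g → pointwise λ n → +-comm (f n) (g n)
          }
        ; *-cong = λ p q → pointwise (*ₛ-cong (at p) (at q))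
        ; *-assoc = λ f g h → pointwise (*ₛ-assoc f g h)
        ; *-identity = (λ f → pointwise (*ₛ-identityˡ f))
                     , (λ f → pointwise λ n → trans (*ₛ-comm f 1ₛ n) (*ₛ-identityˡ f n))
        ; distrib = (λ f g h → pointwise λ n →
                       trans (*ₛ-comm f (g +ₛ h) n)
                      (trans (*ₛ-distribʳ f g h n) (+-cong (*ₛ-comm g f n) (*ₛ-comm h f n))))
                  , (λ h f g → pointwise (*ₛ-distribʳ h f g))
        }
      ; *-comm = λ f g → pointwise (*ₛ-comm f g)
      }
    }

  open Exp (CommutativeRing.semiring commutativeRing) public using () renaming (_^_ to _^ₛ_)

  -- Orders of vanishing and leading coefficients.

  VanishesBelow : ℕ → Series → Set
  VanishesBelow k f = ∀ j → j ℕ.< k → f j ≈ 0#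

  *ₛ-vanishes : ∀ l f g → VanishesBelow l g → VanishesBelow l (f *ₛ g)
  *ₛ-vanishes l f g g-l zero    j<l = trans (*-congˡ (g-l 0 j<l)) (zeroʳ _)
  *ₛ-vanishes l f g g-l (suc j) j<l = trans
    (+-cong (trans (*-congˡ (g-l (suc j) j<l)) (zeroʳ _))
            (*ₛ-vanishes l (tail f) g g-l j (ℕ.<-trans (ℕ.n<1+n j) j<l)))
    (+-identityˡ 0#)

  *ₛ-vanishesBelow : ∀ k l f g → VanishesBelow k f → VanishesBelow l g → VanishesBelow (k ℕ.+ l) (f *ₛ g)
  *ₛ-vanishesBelow zero    l f g f-k g-l j j< = *ₛ-vanishes l f g g-l j j<
  *ₛ-vanishesBelow (suc k) l f g f-k g-l zero j< = trans (*-congʳ (f-k 0 (s≤s z≤n))) (zeroˡ _)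
  *ₛ-vanishesBelow (suc k) l f g f-k g-l (suc j) (s≤s j<) = trans
    (+-cong (trans (*-congʳ (f-k 0 (s≤s z≤n))) (zeroˡ _))
            (*ₛ-vanishesBelow k l (tail f) g (λ i i<k → f-k (suc i) (s≤s i<k)) g-l j j<))
    (+-identityˡ 0#)

  -- Every other product that contributes to degree `k + l` has a factor whose index lies below its
  -- vanishing bound.
  *ₛ-leading : ∀ k l f g → VanishesBelow k f → VanishesBelow l g → (f *ₛ g) (k ℕ.+ l) ≈ f k * g l
  *ₛ-leading zero zero    f g f-k g-l = refl
  *ₛ-leading zero (suc l) f g f-k g-l = trans
    (+-congˡ (*ₛ-vanishes (suc l) (tail f) g g-l l (ℕ.n<1+n l))) (+-identityʳ _)
  *ₛ-leading (suc k) l f g f-k g-l = trans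
    (+-cong (trans (*-congʳ (f-k 0 (s≤s z≤n))) (zeroˡ _))
            (*ₛ-leading k l (tail f) g (λ i i<k → f-k (suc i) (s≤s i<k)) g-l))
    (+-identityˡ _)

  -ₛ-vanishesBelow : ∀ {k f g} → VanishesBelow k f → VanishesBelow k g → VanishesBelow k (f +ₛ -ₛ g)
  -ₛ-vanishesBelow f-k g-k j j<k =
    trans (+-cong (f-k j j<k) (trans (-‿cong (g-k j j<k)) -0#≈0#)) (+-identityˡ 0#)

  ^ₛ-vanishesBelow : ∀ {k f} e → VanishesBelow k f → VanishesBelow (e ℕ.* k) (f ^ₛ e)
  ^ₛ-vanishesBelow zero    f-k j ()
  ^ₛ-vanishesBelow {k} (suc e) f-k = *ₛ-vanishesBelow k (e ℕ.* k) _ _ f-k (^ₛ-vanishesBelow e f-k)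

  -- Fixing the leading coefficient to be 1 makes orders add up under products over any coefficient
  -- ring, even one with zero divisors.
  Monic : ℕ → Series → Set
  Monic k f = VanishesBelow k f × f k ≈ 1#

  *ₛ-monic : ∀ {k l f g} → Monic k f → Monic l g → Monic (k ℕ.+ l) (f *ₛ g)
  *ₛ-monic {k} {l} {f} {g} (f-k , fk) (g-l , gl) =
    *ₛ-vanishesBelow k l f g f-k g-l ,
    trans (*ₛ-leading k l f g f-k g-l) (trans (*-cong fk gl) (*-identityˡ 1#))

  ^ₛ-monic : ∀ {k f} e → Monic k f → Monic (e ℕ.* k) (f ^ₛ e)
  ^ₛ-monic zero    f-k = (λ j ()) , refl
  ^ₛ-monic (suc e) f-k = *ₛ-monic f-k (^ₛ-monic e f-k)

  -ₛ-monic : ∀ {k f g} → Monic k f → VanishesBelow (suc k) g → Monic k (f +ₛ -ₛ g)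
  -ₛ-monic {k} (f-k , fk) g-k =
    -ₛ-vanishesBelow f-k (λ j j<k → g-k j (ℕ.m<n⇒m<1+n j<k)) ,
    trans (+-cong fk (trans (-‿cong (g-k k (ℕ.n<1+n k))) -0#≈0#)) (+-identityʳ 1#)

  Monic-resp : ∀ {k f g} → f ≈ₛ g → Monic k f → Monic k g
  Monic-resp f≈g (f-k , fk) =
    (λ j j<k → trans (sym (at f≈g j)) (f-k j j<k)) , trans (sym (at f≈g _)) fk

  -- Congruence modulo powers of `X`, and fixed points of contractions.

  infix 4 _≈[_]_

  _≈[_]_ : Series → ℕ → Series → Set
  f ≈[ k ] g = ∀ j → j ℕ.< k → f j ≈ g j

  *ₛ-cong-[] : ∀ {k f f′ g g′} → f ≈[ k ] f′ → g ≈[ k ] g′ → f *ₛ g ≈[ k ] f′ *ₛ g′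
  *ₛ-cong-[] f≈ g≈ zero    j<k = *-cong (f≈ 0 j<k) (g≈ 0 j<k)
  *ₛ-cong-[] {k} {f} {f′} f≈ g≈ (suc j) j<k@(s≤s j<k′) = +-cong (*-cong (f≈ 0 (s≤s z≤n)) (g≈ (suc j) j<k))
    (*ₛ-cong-[] {f = tail f} {tail f′} (λ i i<k → f≈ (suc i) (s≤s i<k)) (λ i i<k → g≈ i (ℕ.m<n⇒m<1+n i<k)) j j<k′)

  ^ₛ-cong-[] : ∀ {k f g} e → f ≈[ k ] g → f ^ₛ e ≈[ k ] g ^ₛ e
  ^ₛ-cong-[] zero    f≈g j j<k = refl
  ^ₛ-cong-[] (suc e) f≈g = *ₛ-cong-[] f≈g (^ₛ-cong-[] e f≈g)

  -- A factor without constant term moves the other factor up by one degree, so knowing `g` modulo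
  -- `X ^ k` is enough. This gain makes the map that defines the branch a contraction.
  *ₛ-cong-gain : ∀ {k f f′ g g′} → f 0 ≈ 0# → f′ 0 ≈ 0# → f ≈[ suc k ] f′ → g ≈[ k ] g′ →
                 f *ₛ g ≈[ suc k ] f′ *ₛ g′
  *ₛ-cong-gain f0 f′0 f≈ g≈ zero j<k =
    trans (trans (*-congʳ f0) (zeroˡ _)) (sym (trans (*-congʳ f′0) (zeroˡ _)))
  *ₛ-cong-gain {f = f} {f′} f0 f′0 f≈ g≈ (suc j) (s≤s j<k) = +-cong
    (trans (trans (*-congʳ f0) (zeroˡ _)) (sym (trans (*-congʳ f′0) (zeroˡ _))))
    (*ₛ-cong-[] {f = tail f} {tail f′} (λ i i<k → f≈ (suc i) (s≤s i<k)) g≈ j j<k)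

  constant-homo : IsRingHomomorphism rawRing (CommutativeRing.rawRing commutativeRing) constant
  constant-homo = record
    { isSemiringHomomorphism = record
      { isNearSemiringHomomorphism = record
        { +-isMonoidHomomorphism = record
          { isMagmaHomomorphism = record
            { isRelHomomorphism = record
              { cong = λ a≈b → pointwise λ { zero → a≈b ; (suc n) → refl } }
            ; homo = λ a b → pointwise λ { zero → refl ; (suc n) → sym (+-identityˡ 0#) }
            }
          ; ε-homo = pointwise λ { zero → refl ; (suc n) → refl }
          }
        ; *-homo = λ a b → pointwise λ
          { zero    → refl
          ; (suc n) → sym (trans (constant-*ₛ a (constant b) (suc n)) (zeroʳ a))
          }
        }
      ; 1#-homo = pointwise λ n → refl
      }
    ; -‿homo = λ a → pointwise λ { zero → refl ; (suc n) → sym -0#≈0# }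
    }

  -- The contraction principle for the X-adic metric: each iteration from 0 settles one more
  -- coefficient.
  module FixedPoint (Φ : Series → Series)
                    (contraction : ∀ {k f g} → f ≈[ k ] g → Φ f ≈[ suc k ] Φ g) where

    private
      iterate : ℕ → Series
      iterate zero    = 0ₛ
      iterate (suc k) = Φ (iterate k)

      stable : ∀ k → iterate k ≈[ k ] iterate (suc k)
      stable zero    j ()
      stable (suc k) = contraction (stable k)

      stable-+ : ∀ d k → iterate k ≈[ k ] iterate (d ℕ.+ k)
      stable-+ zero    k j j<k = refl
      stable-+ (suc d) k j j<k = trans (stable-+ d k j j<k) (stable (d ℕ.+ k) j (ℕ.<-≤-trans j<k (ℕ.m≤n+m k d)))

    fix : Series
    -- `iterate k` is final in degrees below `k`, so degree `j` is final from `suc j` on.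
    fix j = iterate (suc j) j

    private
      fix≈iterate : ∀ k → fix ≈[ k ] iterate k
      fix≈iterate k j j<k = ≡.subst (λ i → fix j ≈ iterate i j) (ℕ.m∸n+n≡m j<k)
        (stable-+ (k ℕ.∸ suc j) (suc j) j (ℕ.n<1+n j))

    fix≈Φfix : fix ≈ₛ Φ fix
    fix≈Φfix = pointwise λ j → sym (contraction (fix≈iterate j) j (ℕ.n<1+n j))

  -- `P` is a positive form of being nonzero. If every coefficient is zero or in `P`, the lowest one
  -- in `P` can be found, and the product of the two leading coefficients witnesses that the product
  -- is nonzero. This is applied over F and then again over F[[X]], where `P` asks for a nonzero
  -- coefficient.
  module Nonzero (P : Carrier → Set) (P-resp : ∀ {x y} → x ≈ y → P x → P y)
                 (P-* : ∀ {x y} → P x → P y → P (x * y)) where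

    private
      search : ∀ f → (∀ m → f m ≈ 0# ⊎ P (f m)) → ∀ m →
               VanishesBelow m f ⊎ ∃ λ l → VanishesBelow l f × P (f l)
      search f dec zero = inj₁ (λ j ())
      search f dec (suc m) with search f dec m
      ... | inj₂ found = inj₂ found
      ... | inj₁ f-m with dec m
      ...   | inj₂ pfm = inj₂ (m , f-m , pfm)
      ...   | inj₁ fm≈0 = inj₁ extend
        where
        extend : VanishesBelow (suc m) f
        extend j j<1+m with ℕ.m<1+n⇒m<n∨m≡n j<1+m
        ... | inj₁ j<m     = f-m j j<m
        ... | inj₂ ≡.refl  = fm≈0

      least : ∀ f → (∀ m → f m ≈ 0# ⊎ P (f m)) → ∀ m → P (f m) → ∃ λ l → VanishesBelow l f × P (f l)
      least f dec m pfm with search f dec m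
      ... | inj₁ f-m   = m , f-m , pfm
      ... | inj₂ found = found

    *ₛ-nonzero : ∀ f g → (∀ m → f m ≈ 0# ⊎ P (f m)) → (∀ m → g m ≈ 0# ⊎ P (g m)) →
                 (∃ λ m → P (f m)) → (∃ λ m → P (g m)) → ∃ λ m → P ((f *ₛ g) m)
    *ₛ-nonzero f g decf decg (m , pfm) (m′ , pgm′) with least f decf m pfm | least g decg m′ pgm′
    ... | k , f-k , pfk | l , g-l , pgl =
      k ℕ.+ l , P-resp (sym (*ₛ-leading k l f g f-k g-l)) (P-* pfk pgl)

  -- Applied over F[[X]], where the new variable records the degree of a term.
  monomialₛ : ℕ → Carrier → Series
  monomialₛ zero    a = constant a
  monomialₛ (suc d) a = shift (monomialₛ d a)

  monomialₛ-≡ : ∀ d a → monomialₛ d a d ≈ a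
  monomialₛ-≡ zero    a = refl
  monomialₛ-≡ (suc d) a = monomialₛ-≡ d a

  monomialₛ-≢ : ∀ d a m → d ≢ m → monomialₛ d a m ≈ 0#
  monomialₛ-≢ zero    a zero    d≢m = contradiction ≡.refl d≢m
  monomialₛ-≢ zero    a (suc m) d≢m = refl
  monomialₛ-≢ (suc d) a zero    d≢m = refl
  monomialₛ-≢ (suc d) a (suc m) d≢m = monomialₛ-≢ d a m (d≢m ∘ ≡.cong suc)

  monomialₛ-cong : ∀ d {a b} → a ≈ b → ∀ m → monomialₛ d a m ≈ monomialₛ d b m
  monomialₛ-cong zero    a≈b zero    = a≈b
  monomialₛ-cong zero    a≈b (suc m) = refl
  monomialₛ-cong (suc d) a≈b zero    = refl
  monomialₛ-cong (suc d) a≈b (suc m) = monomialₛ-cong d a≈b m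

  monomialₛ-* : ∀ d d′ a a′ m → monomialₛ (d ℕ.+ d′) (a * a′) m ≈ (monomialₛ d a *ₛ monomialₛ d′ a′) m
  monomialₛ-* zero d′ a a′ m = trans (scale d′ m) (sym (constant-*ₛ a (monomialₛ d′ a′) m))
    where
    scale : ∀ d m → monomialₛ d (a * a′) m ≈ a * monomialₛ d a′ m
    scale zero    zero    = refl
    scale zero    (suc m) = sym (zeroʳ a)
    scale (suc d) zero    = sym (zeroʳ a)
    scale (suc d) (suc m) = scale d m
  monomialₛ-* (suc d) d′ a a′ zero    = sym (shift-*ₛ (monomialₛ d a) (monomialₛ d′ a′) zero)
  monomialₛ-* (suc d) d′ a a′ (suc m) = trans (monomialₛ-* d d′ a a′ m)
    (sym (shift-*ₛ (monomialₛ d a) (monomialₛ d′ a′) (suc m)))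

-- Exponent vectors and monomials.

infixl 6 _⊕_

_⊕_ : ∀ {v} → Vec ℕ v → Vec ℕ v → Vec ℕ v
_⊕_ = zipWith ℕ._+_

single : ∀ {v} → Fin v → ℕ → Vec ℕ v
single zero    k = k ∷ replicate _ 0
single (suc i) k = 0 ∷ single i k

sum-⊕ : ∀ {v} (e e′ : Vec ℕ v) → Vec.sum (e ⊕ e′) ≡ Vec.sum e ℕ.+ Vec.sum e′
sum-⊕ []      []        = ≡.refl
sum-⊕ (a ∷ e) (b ∷ e′) = ≡.trans (≡.cong (a ℕ.+ b ℕ.+_) (sum-⊕ e e′)) (interchange a b _ _)
  where open CommutativeSemigroupProperties ℕ.+-commutativeSemigroup using (interchange)

sum-zeros : ∀ v → Vec.sum (replicate v 0) ≡ 0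
sum-zeros zero    = ≡.refl
sum-zeros (suc v) = sum-zeros v

sum-single : ∀ {v} (i : Fin v) k → Vec.sum (single i k) ≡ k
sum-single {suc v} zero k = ≡.trans (≡.cong (k ℕ.+_) (sum-zeros v)) (ℕ.+-identityʳ k)
sum-single (suc i) k = sum-single i k

module Monomial (A : CommutativeRing 0ℓ 0ℓ) where

  open CommutativeRing A hiding (zero)
  open RawMonoid *-rawMonoid using () renaming (sum to product)
  open Exp semiring public using (_^_; ^-congˡ; ^-homo-*)
  open CommutativeSemigroupProperties *-commutativeSemigroup using (interchange)

  1^ : ∀ k → 1# ^ k ≈ 1#
  1^ zero    = refl
  1^ (suc k) = trans (*-identityˡ _) (1^ k)

  monomial : ∀ {v} → (Fin v → Carrier) → Vec ℕ v → Carrier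
  monomial x e = product (λ i → x i ^ lookup e i)

  monomial-⊕ : ∀ {v} (x : Fin v → Carrier) e e′ → monomial x (e ⊕ e′) ≈ monomial x e * monomial x e′
  monomial-⊕ x []      []        = sym (*-identityˡ 1#)
  monomial-⊕ x (a ∷ e) (b ∷ e′) = trans
    (*-cong (^-homo-* (x zero) a b) (monomial-⊕ (x ∘ suc) e e′)) (interchange _ _ _ _)

  monomial-zeros : ∀ {v} (x : Fin v → Carrier) → monomial x (replicate v 0) ≈ 1#
  monomial-zeros {zero}  x = refl
  monomial-zeros {suc v} x = trans (*-identityˡ _) (monomial-zeros (x ∘ suc))

  monomial-single : ∀ {v} (x : Fin v → Carrier) i k → monomial x (single i k) ≈ x i ^ k
  monomial-single x zero    k = trans (*-congˡ (monomial-zeros (x ∘ suc))) (*-identityʳ _)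
  monomial-single x (suc i) k = trans (*-identityˡ _) (monomial-single (x ∘ suc) i k)

  -- The rewriting rule has only coefficients 1, so a normal form is a bare list of exponents in
  -- which repetition stands for multiplicity.
  sumOver : ∀ {v} → (Fin v → Carrier) → List (Vec ℕ v) → Carrier
  sumOver x []       = 0#
  sumOver x (e ∷ es) = monomial x e + sumOver x es

  sumOver-++ : ∀ {v} (x : Fin v → Carrier) es es′ → sumOver x (es ++ es′) ≈ sumOver x es + sumOver x es′
  sumOver-++ x []       es′ = sym (+-identityˡ _)
  sumOver-++ x (e ∷ es) es′ = trans (+-congˡ (sumOver-++ x es es′)) (sym (+-assoc _ _ _))

-- Rewriting monomials modulo the equations of the curve.

module Normalisation (p : ℕ) where

  q : ℕ
  q = suc p

  -- The homogeneous coordinates are (z : y₀ : … : yₖ).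
  OnCurve : (A : CommutativeRing 0ℓ 0ℓ) → let open CommutativeRing A hiding (zero) in
            ∀ {k} → (Fin (suc (suc k)) → Carrier) → Set
  OnCurve A {k} x = ∀ (j : Fin k) →
    x (inject₁ (suc j)) ^ q ≈ x (inject₁ (suc j)) * x (fromℕ (suc k)) ^ p + x zero ^ p * x (suc (suc j))
    where
    open CommutativeRing A hiding (zero)
    open Monomial A

  -- The last exponent is free, since no equation rewrites a power of the last variable.
  Normal : ∀ {k} → Vec ℕ (suc k) → Set
  Normal (a ∷ [])        = ⊤
  Normal (e ∷ u@(_ ∷ _)) = e ℕ.< q × Normal u

  NormalOfDegree : ∀ {k} → ℕ → Vec ℕ (suc (suc k)) → Set
  NormalOfDegree m e = Normal (Vec.tail e) × Vec.sum e ≡ m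

  -- The list is chosen before the ring, so that one rewriting serves both the branch over F[[X]]
  -- and the points over F.
  NormalForm : ∀ {k} → Vec ℕ (suc (suc k)) → Set₁
  NormalForm {k} e = Σ (List (Vec ℕ (suc (suc k)))) λ es →
    All (NormalOfDegree (Vec.sum e)) es ×
    (∀ A x → OnCurve A x → let open CommutativeRing A hiding (zero) in let open Monomial A in monomial x e ≈ sumOver x es)

  private
    insert : ∀ {k} → ℕ → Vec ℕ (suc k) → Vec ℕ (suc (suc k))
    insert e (c ∷ u) = c ∷ e ∷ u

    -- Forgetting `y₀` leaves a solution of the same system with one equation fewer, because the
    -- other equations do not involve `y₀` and the last coordinate stays the same.
    drop₁ : ∀ {a} {A : Set a} {k} → (Fin (suc (suc k)) → A) → Fin (suc k) → A
    drop₁ x zero    = x zero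
    drop₁ x (suc i) = x (suc (suc i))

    module _ (A : CommutativeRing 0ℓ 0ℓ) where
      open CommutativeRing A hiding (zero)
      open Monomial A
      open CommutativeSemigroupProperties *-commutativeSemigroup using (x∙yz≈y∙xz)

      monomial-insert : ∀ {k} (x : Fin (suc (suc k)) → Carrier) e u →
                        monomial x (insert e u) ≈ x (suc zero) ^ e * monomial (drop₁ x) u
      monomial-insert x e (c ∷ u) = x∙yz≈y∙xz _ _ _

      sumOver-insert : ∀ {k} (x : Fin (suc (suc k)) → Carrier) e us →
                       sumOver x (map (insert e) us) ≈ x (suc zero) ^ e * sumOver (drop₁ x) us
      sumOver-insert x e []       = sym (zeroʳ _)
      sumOver-insert x e (u ∷ us) = trans (+-cong (monomial-insert x e u) (sumOver-insert x e us))
                                          (sym (distribˡ _ _ _))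

    sum-insert : ∀ {k} e (u : Vec ℕ (suc k)) → Vec.sum (insert e u) ≡ e ℕ.+ Vec.sum u
    sum-insert e (c ∷ u) = x∙yz≈y∙xz c e (Vec.sum u)
      where open CommutativeSemigroupProperties ℕ.+-commutativeSemigroup

    insert-normalForm : ∀ {k} e (u : Vec ℕ (suc (suc k))) → e ℕ.< q → NormalForm u → NormalForm (insert e u)
    insert-normalForm e u e<q (us , normal , value) =
      map (insert e) us , All.map⁺ (All.map (λ {u′} → insert-normal u′) normal) , λ A x on →
      let open CommutativeRing A hiding (zero) in let open Monomial A in
      trans (monomial-insert A x e u)
     (trans (*-congˡ (value A (drop₁ x) (on ∘ suc))) (sym (sumOver-insert A x e us)))
      where
      insert-normal : ∀ u′ → NormalOfDegree (Vec.sum u) u′ → NormalOfDegree (Vec.sum (insert e u)) (insert e u′)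
      insert-normal u′@(c ∷ a ∷ u″) (normal′ , s) = (e<q , normal′) ,
        ≡.trans (sum-insert e u′) (≡.trans (≡.cong (e ℕ.+_) s) (≡.sym (sum-insert e u)))

    add-normalForm : ∀ {k} (e e₁ e₂ : Vec ℕ (suc (suc k))) →
      Vec.sum e₁ ≡ Vec.sum e → Vec.sum e₂ ≡ Vec.sum e →
      (∀ A x → OnCurve A x → let open CommutativeRing A hiding (zero) in let open Monomial A in
               monomial x e ≈ monomial x e₁ + monomial x e₂) →
      NormalForm e₁ → NormalForm e₂ → NormalForm e
    add-normalForm e e₁ e₂ s₁ s₂ rel (es₁ , n₁ , v₁) (es₂ , n₂ , v₂) =
      es₁ ++ es₂ ,
      All.++⁺ (≡.subst (λ m → All (NormalOfDegree m) es₁) s₁ n₁)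
              (≡.subst (λ m → All (NormalOfDegree m) es₂) s₂ n₂) ,
      λ A x on → let open CommutativeRing A hiding (zero) in let open Monomial A in
      trans (rel A x on) (trans (+-cong (v₁ A x on) (v₂ A x on)) (sym (sumOver-++ x es₁ es₂)))

    -- A factor `y₀^q` is replaced by `y₀ yₖ₊₁^p` here and by `z^p y₁` in `reduced′`, the two terms
    -- of the first equation.
    reduced : ∀ {k} → ℕ → ℕ → Vec ℕ (suc k) → Vec ℕ (suc (suc (suc k)))
    reduced {k} c e u = c ∷ suc e ∷ (u ⊕ single (fromℕ k) p)

    reduced′ : ∀ {k} → ℕ → ℕ → Vec ℕ (suc k) → Vec ℕ (suc (suc (suc k)))
    reduced′ c e u = (c ℕ.+ p) ∷ e ∷ (u ⊕ single zero 1)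

    sum-⊕-single : ∀ {v} (u : Vec ℕ v) i k → Vec.sum (u ⊕ single i k) ≡ Vec.sum u ℕ.+ k
    sum-⊕-single u i k = ≡.trans (sum-⊕ u (single i k)) (≡.cong (Vec.sum u ℕ.+_) (sum-single i k))

    sum-reduced : ∀ {k} c e (u : Vec ℕ (suc k)) → Vec.sum (reduced c e u) ≡ Vec.sum (c ∷ (q ℕ.+ e) ∷ u)
    sum-reduced {k} c e u = ≡.trans (≡.cong (λ s → c ℕ.+ (suc e ℕ.+ s)) (sum-⊕-single u (fromℕ k) p))
      (solve 4 (λ c e s p → c :+ (con 1 :+ e :+ (s :+ p)) := c :+ (con 1 :+ p :+ e :+ s)) ≡.refl c e (Vec.sum u) p)
      where open +-*-Solver

    sum-reduced′ : ∀ {k} c e (u : Vec ℕ (suc k)) → Vec.sum (reduced′ c e u) ≡ Vec.sum (c ∷ (q ℕ.+ e) ∷ u)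
    sum-reduced′ {k} c e u = ≡.trans (≡.cong (λ s → c ℕ.+ p ℕ.+ (e ℕ.+ s)) (sum-⊕-single u zero 1))
      (solve 4 (λ c e s p → c :+ p :+ (e :+ (s :+ con 1)) := c :+ (con 1 :+ p :+ e :+ s)) ≡.refl c e (Vec.sum u) p)
      where open +-*-Solver

    module _ (A : CommutativeRing 0ℓ 0ℓ) where
      open CommutativeRing A hiding (zero)
      open Monomial A
      open RingSolver commutativeSemiring using (solve; _:=_; _:+_; _:*_)
      private module ≈-Reasoning = SetoidReasoning setoid

      monomial-reduce : ∀ {k} (x : Fin (suc (suc (suc k))) → Carrier) → OnCurve A x → ∀ c e u →
        monomial x (c ∷ (q ℕ.+ e) ∷ u) ≈ monomial x (reduced c e u) + monomial x (reduced′ c e u)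
      monomial-reduce {k} x on c e u = begin
        z ^ c * (y ^ (q ℕ.+ e) * U)
          ≈⟨ *-congˡ (*-congʳ (trans (^-homo-* y q e) (*-congʳ (on zero)))) ⟩
        z ^ c * ((y * v ^ p + z ^ p * y′) * y ^ e * U)
          ≈⟨ solve 7 (λ Z E U y V P y′ →
               Z :* ((y :* V :+ P :* y′) :* E :* U) := Z :* (y :* E :* (U :* V)) :+ Z :* P :* (E :* (U :* y′)))
               refl (z ^ c) (y ^ e) U y (v ^ p) (z ^ p) y′ ⟩
        z ^ c * (y * y ^ e * (U * v ^ p)) + z ^ c * z ^ p * (y ^ e * (U * y′))
          ≈⟨ +-cong (*-congˡ (*-congˡ (monomial-⊕-single (fromℕ k) p)))
                    (*-cong (^-homo-* z c p)
                            (*-congˡ (trans (monomial-⊕-single zero 1) (*-congˡ (*-identityʳ y′))))) ⟨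
        monomial x (reduced c e u) + monomial x (reduced′ c e u) ∎
        where
        open ≈-Reasoning
        z  = x zero
        y  = x (suc zero)
        y′ = x (suc (suc zero))
        v  = x (fromℕ (suc (suc k)))
        xu = λ i → x (suc (suc i))
        U  = monomial xu u
        monomial-⊕-single : ∀ i d → monomial xu (u ⊕ single i d) ≈ U * xu i ^ d
        monomial-⊕-single i d = trans (monomial-⊕ xu u (single i d)) (*-congˡ (monomial-single xu i d))

  -- Rewriting at `y₀` may raise the later exponents, but it lowers that of `y₀`. Once this is below
  -- `q`, the other variables are treated with one equation fewer, and `y₀` never comes back. Hence
  -- an outer induction on the number of variables and an inner one on the exponent of `y₀`.
  normalForm : 0 ℕ.< p → ∀ {k} (e : Vec ℕ (suc (suc k))) → NormalForm e
  normalForm 0<p {zero} (c ∷ a ∷ []) =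
    (c ∷ a ∷ []) ∷ [] , (tt , ≡.refl) ∷ [] ,
    λ A x on → let open CommutativeRing A hiding (zero) in sym (+-identityʳ _)
  normalForm 0<p {suc k} (c ∷ e ∷ u) = <-rec P step e c u
    where
    P : ℕ → Set₁
    P e = ∀ c u → NormalForm (c ∷ e ∷ u)

    step : ∀ e → (∀ {e′} → e′ ℕ.< e → P e′) → P e
    step e rec c u with e ℕ.<? q
    ... | yes e<q = insert-normalForm e (c ∷ u) e<q (normalForm 0<p (c ∷ u))
    ... | no  e≮q = ≡.subst P (ℕ.m+[n∸m]≡n q≤e) stepped c u
      where
      q≤e = ℕ.≮⇒≥ e≮q
      e′  = e ℕ.∸ q
      stepped : P (q ℕ.+ e′)
      stepped c u = add-normalForm (c ∷ (q ℕ.+ e′) ∷ u) (reduced c e′ u) (reduced′ c e′ u) (sum-reduced c e′ u) (sum-reduced′ c e′ u)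
        (λ A x on → monomial-reduce A x on c e′ u)
        (rec suc-e′<e c (u ⊕ single (fromℕ k) p))
        (rec (ℕ.<-trans (ℕ.n<1+n e′) suc-e′<e) (c ℕ.+ p) (u ⊕ single zero 1))
        where
        -- One of the new terms keeps a factor `y₀`, so the exponent drops only by `p`, which has to
        -- be positive.
        suc-e′<e : suc e′ ℕ.< e
        suc-e′<e = ≡.subst (suc e′ ℕ.<_) (ℕ.m+[n∸m]≡n q≤e) (s≤s (ℕ.+-monoˡ-≤ e′ 0<p))

-- The branch at the ramified point and the orders of monomials along it.

module Weight (p : ℕ) where

  open Normalisation p using (q)

  -- The order along the branch; its base-q digits are the exponents.
  weight : ∀ {k} → Vec ℕ (suc k) → ℕ
  weight (a ∷ [])        = a
  weight (e ∷ u@(_ ∷ _)) = e ℕ.+ q ℕ.* weight u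

module Parametrisation (R : CommutativeRing 0ℓ 0ℓ) (p : ℕ) (0<p : 0 ℕ.< p) where

  open PowerSeries R
  open Normalisation p using (q; OnCurve)
  open Weight p
  private
    module R = CommutativeRing R
    module S = CommutativeRing commutativeRing
  open Monomial commutativeRing using (monomial; 1^; ^-congˡ)

  -- For `z = 1` an equation gives the next coordinate as `y^q - y V^p`, where `V` stands for the
  -- last coordinate.
  step : Series → Series → Series
  step V y = y *ₛ (y ^ₛ p +ₛ -ₛ (V ^ₛ p))

  steps : Series → Series → ℕ → Series
  steps V y zero    = y
  steps V y (suc k) = steps V (step V y) k

  chain : Series → Series → ∀ k → Fin (suc k) → Series
  chain V y k       zero    = y
  chain V y (suc k) (suc i) = chain V (step V y) k i

  chain-last : ∀ V y k → chain V y k (fromℕ k) ≡ steps V y k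
  chain-last V y zero    = ≡.refl
  chain-last V y (suc k) = chain-last V (step V y) k

  step-equation : ∀ V y → y ^ₛ q ≈ₛ y *ₛ V ^ₛ p +ₛ step V y
  step-equation V y = begin
    y *ₛ y ^ₛ p                                             ≈⟨ S.*-congˡ y^p≈ ⟩
    y *ₛ (V ^ₛ p +ₛ (y ^ₛ p +ₛ -ₛ (V ^ₛ p)))                ≈⟨ S.distribˡ _ _ _ ⟩
    y *ₛ V ^ₛ p +ₛ step V y                                 ∎
    where
    open SetoidReasoning S.setoid
    open CommutativeSemigroupProperties S.+-commutativeSemigroup using (x∙yz≈y∙xz)
    y^p≈ : y ^ₛ p ≈ₛ V ^ₛ p +ₛ (y ^ₛ p +ₛ -ₛ (V ^ₛ p))
    y^p≈ = S.sym (S.trans (x∙yz≈y∙xz _ _ _)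
             (S.trans (S.+-congˡ (S.-‿inverseʳ (V ^ₛ p))) (S.+-identityʳ _)))

  chain-equation : ∀ V y k (j : Fin k) → chain V y k (inject₁ j) ^ₛ q ≈ₛ
                   chain V y k (inject₁ j) *ₛ V ^ₛ p +ₛ chain V y k (suc j)
  chain-equation V y (suc k) zero    = step-equation V y
  chain-equation V y (suc k) (suc j) = chain-equation V (step V y) k j

  private
    -- `V` enters a step only multiplied by `y`, which has no constant term, so an error in `V` is
    -- pushed up by one degree.
    steps-contraction : ∀ {k V W} l y z → y 0 R.≈ R.0# → z 0 R.≈ R.0# →
      V ≈[ k ] W → y ≈[ suc k ] z → steps V y l ≈[ suc k ] steps W z l
    steps-contraction zero    y z y0 z0 V≈W y≈z = y≈z
    steps-contraction {k} {V} {W} (suc l) y z y0 z0 V≈W y≈z = steps-contraction l _ _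
      (R.trans (R.*-congʳ y0) (R.zeroˡ _)) (R.trans (R.*-congʳ z0) (R.zeroˡ _)) V≈W
      (*ₛ-cong-gain {f = y} {z} y0 z0 y≈z (λ j j<k → R.+-cong
        (^ₛ-cong-[] {f = y} {z} p (λ i i<k → y≈z i (ℕ.m<n⇒m<1+n i<k)) j j<k)
        (R.-‿cong (^ₛ-cong-[] {f = V} {W} p V≈W j j<k))))

  module _ (n : ℕ) where

    private
      -- From `y₀ = X` and a guess for the last coordinate all coordinates can be computed. The
      -- guess is right exactly when the chain ends in it, that is, when it is a fixed point.
      closure : Series → Series
      closure V = steps V X n

      closure-contraction : ∀ {k V W} → V ≈[ k ] W → closure V ≈[ suc k ] closure W
      closure-contraction V≈W = steps-contraction n X X R.refl R.refl V≈W (λ j j<k → R.refl)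

      module V = FixedPoint closure closure-contraction

    V : Series
    V = V.fix

    V≈steps : V ≈ₛ steps V X n
    V≈steps = V.fix≈Φfix

    branch : Fin (suc (suc n)) → Series
    branch zero    = 1ₛ
    branch (suc i) = chain V X n i

    branch-last : branch (fromℕ (suc n)) ≈ₛ V
    branch-last = S.trans (S.reflexive (chain-last V X n)) (S.sym V≈steps)

    branch-onCurve : OnCurve commutativeRing branch
    branch-onCurve j = S.trans (chain-equation V X n j) (S.+-cong
      (S.*-congˡ (^-congˡ p (S.sym branch-last)))
      (S.sym (S.trans (S.*-congʳ (1^ p)) (S.*-identityˡ _))))

  private
    step-vanishes : ∀ {c V y} → VanishesBelow c V → VanishesBelow c y → VanishesBelow (q ℕ.* c) (step V y)
    step-vanishes {c} V-c y-c = *ₛ-vanishesBelow c (p ℕ.* c) _ _ y-c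
      (-ₛ-vanishesBelow (^ₛ-vanishesBelow p y-c) (^ₛ-vanishesBelow p V-c))

    step-vanishes₀ : ∀ {c V y} → VanishesBelow c y → VanishesBelow c (step V y)
    step-vanishes₀ {c} {V} {y} y-c j j<c =
      R.trans (S.*-comm y _ .at j) (*ₛ-vanishes c _ y y-c j j<c)

    steps-vanishes : ∀ {c V} l {y} → VanishesBelow c y → VanishesBelow c (steps V y l)
    steps-vanishes zero    y-c = y-c
    steps-vanishes {V = V} (suc l) {y} y-c = steps-vanishes l (step-vanishes₀ {V = V} {y} y-c)

    VanishesBelow-resp : ∀ {c f g} → f ≈ₛ g → VanishesBelow c f → VanishesBelow c g
    VanishesBelow-resp f≈g f-c j j<c = R.trans (R.sym (at f≈g j)) (f-c j j<c)

    -- Each round multiplies the known lower bound for the order of V by q.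
    bootstrap : ∀ l {c V y} → VanishesBelow c V → VanishesBelow c y → V ≈ₛ steps V y l →
                VanishesBelow (q ℕ.^ l ℕ.* c) V
    bootstrap zero    {c} {V} V-c y-c V≈ = ≡.subst (λ k → VanishesBelow k V) (≡.sym (ℕ.*-identityˡ c)) V-c
    bootstrap (suc l) {c} {V} {y} V-c y-c V≈ = ≡.subst (λ k → VanishesBelow k V) eq
      -- The remaining steps cannot lower the order, so the bound `q * c` for `step V y` passes to
      -- `V` as well.
      (bootstrap l (VanishesBelow-resp (S.sym V≈) (steps-vanishes l stepped)) stepped V≈)
      where
      stepped : VanishesBelow (q ℕ.* c) (step V y)
      stepped = step-vanishes {V = V} {y} V-c y-c
      eq : q ℕ.^ l ℕ.* (q ℕ.* c) ≡ q ℕ.^ suc l ℕ.* c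
      eq = ≡.trans (≡.sym (ℕ.*-assoc (q ℕ.^ l) q c)) (≡.cong (ℕ._* c) (ℕ.*-comm (q ℕ.^ l) q))

    -- `V^p` vanishes to a higher order than `y^p`, so the leading term is that of `y^q`. This needs
    -- an order of `V` above that of `y` in advance, which is what `bootstrap` supplies.
    step-monic : ∀ {w b V y} → w ℕ.< b → VanishesBelow b V → Monic w y → Monic (q ℕ.* w) (step V y)
    step-monic {w} {b} {V} {y} w<b V-b y-w = *ₛ-monic y-w (-ₛ-monic (^ₛ-monic p y-w)
      (λ j j< → ^ₛ-vanishesBelow p V-b j (ℕ.<-≤-trans j< (ℕ.*-monoʳ-< p {{ℕ.>-nonZero 0<p}} w<b))))

    -- Each step multiplies the order by `q`, so the exponents act as base-`q` digits. The bound on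
    -- `V` is the same at every stage, because `q^(k+1) w = q^k (q w)`.
    chain-monic : ∀ k {w V y} → 0 ℕ.< w → VanishesBelow (q ℕ.^ k ℕ.* w) V → Monic w y →
                  ∀ u → Monic (w ℕ.* weight u) (monomial (chain V y k) u)
    chain-monic zero {w} {V} {y} 0<w V-b y-w (a ∷ []) = Monic-resp (S.sym (S.*-identityʳ _))
      (≡.subst (λ m → Monic m (y ^ₛ a)) (ℕ.*-comm a w) (^ₛ-monic a y-w))
    chain-monic (suc k) {w} {V} {y} 0<w V-b y-w (e ∷ u@(_ ∷ _)) =
      ≡.subst (λ m → Monic m (monomial (chain V y (suc k)) (e ∷ u))) eq
        (*ₛ-monic (^ₛ-monic e y-w)
          (chain-monic k {q ℕ.* w} (ℕ.<-≤-trans 0<w (ℕ.m≤m+n w _))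
            (≡.subst (λ m → VanishesBelow m V) b≡ V-b)
            (step-monic w<b V-b y-w) u))
      where
      b≡ : q ℕ.^ suc k ℕ.* w ≡ q ℕ.^ k ℕ.* (q ℕ.* w)
      b≡ = ≡.trans (≡.cong (ℕ._* w) (ℕ.*-comm q (q ℕ.^ k))) (ℕ.*-assoc (q ℕ.^ k) q w)
      w<b : w ℕ.< q ℕ.^ suc k ℕ.* w
      w<b = ℕ.<-≤-trans (≡.subst (ℕ._< q ℕ.* w) (ℕ.*-identityˡ w) (ℕ.*-monoˡ-< w {{ℕ.>-nonZero 0<w}} (s≤s 0<p)))
              (≡.subst (q ℕ.* w ℕ.≤_) (≡.sym b≡) (ℕ.m≤n*m (q ℕ.* w) (q ℕ.^ k) {{ℕ.m^n≢0 q k}}))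
      eq : e ℕ.* w ℕ.+ q ℕ.* w ℕ.* weight u ≡ w ℕ.* (e ℕ.+ q ℕ.* weight u)
      eq = solve 4 (λ e w q h → e :* w :+ q :* w :* h := w :* (e :+ q :* h)) ≡.refl e w q (weight u)
        where
        open +-*-Solver

  branch-monic : ∀ n (e : Vec ℕ (suc (suc n))) → Monic (weight (Vec.tail e)) (monomial (branch n) e)
  branch-monic n (c ∷ u) = Monic-resp
    (S.sym (S.trans (S.*-congʳ (1^ c)) (S.*-identityˡ _)))
    (≡.subst (λ m → Monic m (monomial (chain (V n) X n) u)) (ℕ.*-identityˡ (weight u))
      (chain-monic n {1} (s≤s z≤n) V-q X-monic u))
    where
    X-monic : Monic 1 X
    X-monic = (λ { zero j<1 → R.refl ; (suc j) (s≤s ()) }) , R.refl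
    -- `y₀ = X` gives the crude bound 1, from which the bootstrap reaches `q ^ n`.
    V-q : VanishesBelow (q ℕ.^ n ℕ.* 1) (V n)
    V-q = bootstrap n (VanishesBelow-resp (S.sym (V≈steps n)) (steps-vanishes n (proj₁ X-monic)))
                      (proj₁ X-monic) (V≈steps n)

-- Enumerating and counting the reduced monomials.

lookup-injective : ∀ {a} {A : Set a} {xs : List A} → Unique xs →
                   ∀ i j → List.lookup xs i ≡ List.lookup xs j → i ≡ j
lookup-injective (x∉ ∷ u) zero    zero    eq = ≡.refl
lookup-injective (x∉ ∷ u) zero    (suc j) eq = contradiction eq (All.lookup x∉ (∈-lookup j))
lookup-injective (x∉ ∷ u) (suc i) zero    eq = contradiction (≡.sym eq) (All.lookup x∉ (∈-lookup i))
lookup-injective (x∉ ∷ u) (suc i) (suc j) eq = ≡.cong suc (lookup-injective u i j eq)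

module NormalMonomials (p : ℕ) where

  open Normalisation p using (q; Normal; NormalOfDegree)
  open Weight p

  -- Uniqueness of base-`q` digits: the first exponent is the residue modulo `q`, and the unbounded
  -- last one is the final quotient.
  weight-injective : ∀ {k} {u u′ : Vec ℕ (suc k)} → Normal u → Normal u′ → weight u ≡ weight u′ → u ≡ u′
  weight-injective {u = a ∷ []} {b ∷ []} _ _ eq = ≡.cong (_∷ []) eq
  weight-injective {u = e ∷ u@(_ ∷ _)} {e′ ∷ u′@(_ ∷ _)} (e< , nu) (e′< , nu′) eq =
    ≡.cong₂ _∷_ e≡e′ (weight-injective nu nu′ (ℕ.*-cancelˡ-≡ _ _ q
      (ℕ.+-cancelˡ-≡ e _ _ (≡.trans eq (≡.cong (ℕ._+ q ℕ.* weight u′) (≡.sym e≡e′))))))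
    where
    residue : ∀ {e} h → e ℕ.< q → (e ℕ.+ q ℕ.* h) % q ≡ e
    residue {e} h e<q = ≡.trans (≡.cong (λ m → (e ℕ.+ m) % q) (ℕ.*-comm q h))
                       (≡.trans ([m+kn]%n≡m%n e h q) (m<n⇒m%n≡m e<q))
    e≡e′ : e ≡ e′
    e≡e′ = ≡.trans (≡.sym (residue (weight u) e<)) (≡.trans (≡.cong (_% q) eq) (residue (weight u′) e′<))

  private
    blocks : ∀ {k} → (ℕ → List (Vec ℕ k)) → ℕ → ℕ → List (Vec ℕ (suc k))
    blocks f t zero    = []
    blocks f t (suc j) = map (j ∷_) (f (t ℕ.∸ j)) ++ blocks f t j

  -- Truncated subtraction makes the blocks with e ≥ t empty.
  normals : ∀ k → ℕ → List (Vec ℕ (suc k))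
  normals zero    t = map (_∷ []) (upTo t)
  normals (suc k) t = blocks (normals k) t q

  private
    ∈-blocks : ∀ {k} (f : ℕ → List (Vec ℕ k)) t j {e u} → e ℕ.< j → u ∈ f (t ℕ.∸ e) → (e ∷ u) ∈ blocks f t j
    ∈-blocks f t (suc j) {e} e<j u∈ with e ℕ.≟ j
    ... | yes ≡.refl = ∈-++⁺ˡ (∈-map⁺ (j ∷_) u∈)
    ... | no  e≢j    = ∈-++⁺ʳ _ (∈-blocks f t j (ℕ.≤∧≢⇒< (ℕ.≤-pred e<j) e≢j) u∈)

    All-blocks : ∀ {k} {P : Vec ℕ (suc k) → Set} (f : ℕ → List (Vec ℕ k)) t j →
                 (∀ e → e ℕ.< j → All (λ u → P (e ∷ u)) (f (t ℕ.∸ e))) → All P (blocks f t j)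
    All-blocks f t zero    h = []
    All-blocks f t (suc j) h = All.++⁺ (All.map⁺ (h j (ℕ.n<1+n j)))
                                       (All-blocks f t j (λ e e<j → h e (ℕ.m<n⇒m<1+n e<j)))

    Unique-blocks : ∀ {k} (f : ℕ → List (Vec ℕ k)) → (∀ t → Unique (f t)) → ∀ t j → Unique (blocks f t j)
    Unique-blocks f h t zero    = []
    Unique-blocks f h t (suc j) = Unique.++⁺ (Unique.map⁺ Vec.∷-injectiveʳ (h (t ℕ.∸ j))) (Unique-blocks f h t j)
      λ { (u∈ , u∈′) → ℕ.<-irrefl (≡.sym (head≡j u∈)) (All.lookup heads u∈′) }
      where
      heads : All (λ u → Vec.head u ℕ.< j) (blocks f t j)
      heads = All-blocks f t j (λ e e<j → All.universal (λ _ → e<j) _)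
      head≡j : ∀ {u} → u ∈ map (j ∷_) (f (t ℕ.∸ j)) → j ≡ Vec.head u
      head≡j u∈ with ∈-map⁻ (j ∷_) u∈
      ... | _ , _ , ≡.refl = ≡.refl

  ∈-normals : ∀ {k} {u : Vec ℕ (suc k)} {t} → Normal u → Vec.sum u ℕ.< t → u ∈ normals k t
  ∈-normals {u = a ∷ []} _ a<t = ∈-map⁺ (_∷ []) (∈-upTo⁺ (≡.subst (ℕ._< _) (ℕ.+-identityʳ a) a<t))
  ∈-normals {suc k} {u = e ∷ u@(_ ∷ _)} {t} (e<q , nu) s<t =
    ∈-blocks (normals k) t q e<q (∈-normals nu
      (ℕ.m+n≤o⇒m≤o∸n (suc (Vec.sum u)) (≡.subst (ℕ._≤ t) (≡.cong suc (ℕ.+-comm e (Vec.sum u))) s<t)))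

  All-normals : ∀ k t → All (λ u → Normal u × Vec.sum u ℕ.< t) (normals k t)
  All-normals zero t = All.map⁺ (All.tabulate (λ {a} a∈ →
    tt , ≡.subst (ℕ._< t) (≡.sym (ℕ.+-identityʳ a)) (∈-upTo⁻ a∈)))
  All-normals (suc k) t = All-blocks (normals k) t q λ e e<q →
    All.map (λ { {u@(_ ∷ _)} (nu , s<) → (e<q , nu) , shifted e (Vec.sum u) s< }) (All-normals k (t ℕ.∸ e))
    where
    -- A truncated difference that exceeds `s` is positive, so here the subtraction is exact.
    shifted : ∀ e s → s ℕ.< t ℕ.∸ e → e ℕ.+ s ℕ.< t
    shifted e s s< = ≡.subst₂ ℕ._≤_ (ℕ.+-suc e s)
      (ℕ.m+[n∸m]≡n {e} {t} (ℕ.<⇒≤ (ℕ.m∸n≢0⇒n<m λ eq → ℕ.n≮0 (≡.subst (s ℕ.<_) eq s<)))) (ℕ.+-monoʳ-≤ e s<)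

  Unique-normals : ∀ k t → Unique (normals k t)
  Unique-normals zero    t = Unique.map⁺ Vec.∷-injectiveˡ (Unique.upTo⁺ t)
  Unique-normals (suc k) t = Unique-blocks (normals k) (Unique-normals k) t q

  private
    -- The block of `e` has `d (t - e) - T` members, so the blocks with `e < j` together grow
    -- linearly in `t` with slope `j * d`. The constant is kept on the left to stay within the
    -- natural numbers. The bound `t₀ + j` keeps each `t - e` untruncated and in the range of the
    -- hypothesis.
    length-blocks : ∀ {k} (f : ℕ → List (Vec ℕ k)) d T t₀ → (∀ t → t₀ ℕ.≤ t → length (f t) ℕ.+ T ≡ d ℕ.* t) →
      ∀ j → ∃ λ T′ → ∀ t → t₀ ℕ.+ j ℕ.≤ t → length (blocks f t j) ℕ.+ T′ ≡ j ℕ.* d ℕ.* t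
    length-blocks f d T t₀ h zero = 0 , λ t _ → ≡.refl
    length-blocks f d T t₀ h (suc j) with length-blocks f d T t₀ h j
    -- The new block adds its own constant `T`, and `d * j` because its bound is `t - j` instead of
    -- `t`.
    ... | T′ , h′ = T ℕ.+ d ℕ.* j ℕ.+ T′ , λ t t₀+sj≤t →
      let t₀+j≤t : t₀ ℕ.+ j ℕ.≤ t
          t₀+j≤t = ℕ.≤-trans (ℕ.+-monoʳ-≤ t₀ (ℕ.n≤1+n j)) t₀+sj≤t
          l  = length (f (t ℕ.∸ j))
          l′ = length (blocks f t j)
      in begin
      length (map (j ∷_) (f (t ℕ.∸ j)) ++ blocks f t j) ℕ.+ (T ℕ.+ d ℕ.* j ℕ.+ T′)
        ≡⟨ ≡.cong (ℕ._+ _) (≡.trans (List.length-++ (map (j ∷_) (f (t ℕ.∸ j))))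
                                     (≡.cong (ℕ._+ l′) (List.length-map (j ∷_) (f (t ℕ.∸ j))))) ⟩
      l ℕ.+ l′ ℕ.+ (T ℕ.+ d ℕ.* j ℕ.+ T′)
        ≡⟨ solve 5 (λ l l′ T dj T′ → l :+ l′ :+ (T :+ dj :+ T′) := (l :+ T) :+ dj :+ (l′ :+ T′))
             ≡.refl l l′ T (d ℕ.* j) T′ ⟩
      (l ℕ.+ T) ℕ.+ d ℕ.* j ℕ.+ (l′ ℕ.+ T′)
        ≡⟨ ≡.cong₂ ℕ._+_ (≡.cong (ℕ._+ d ℕ.* j) (h _ (ℕ.m+n≤o⇒m≤o∸n t₀ t₀+j≤t))) (h′ t t₀+j≤t) ⟩
      d ℕ.* (t ℕ.∸ j) ℕ.+ d ℕ.* j ℕ.+ j ℕ.* d ℕ.* t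
        ≡⟨ ≡.cong (ℕ._+ j ℕ.* d ℕ.* t) (ℕ.*-distribˡ-+ d (t ℕ.∸ j) j) ⟨
      d ℕ.* (t ℕ.∸ j ℕ.+ j) ℕ.+ j ℕ.* d ℕ.* t
        ≡⟨ ≡.cong (λ t′ → d ℕ.* t′ ℕ.+ j ℕ.* d ℕ.* t) (ℕ.m∸n+n≡m (ℕ.≤-trans (ℕ.m≤n+m j t₀) t₀+j≤t)) ⟩
      d ℕ.* t ℕ.+ j ℕ.* d ℕ.* t
        ≡⟨ ℕ.*-distribʳ-+ t d (j ℕ.* d) ⟨
      suc j ℕ.* d ℕ.* t ∎
      where
      open ≡.≡-Reasoning
      open +-*-Solver

  -- Each of the `k` restricted exponents has `q` choices and the last one is free. The slope
  -- `q ^ k` will be the degree of the curve.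
  length-normals : ∀ k → ∃₂ λ T t₀ → ∀ t → t₀ ℕ.≤ t → length (normals k t) ℕ.+ T ≡ q ℕ.^ k ℕ.* t
  length-normals zero = 0 , 0 , λ t _ → ≡.trans (ℕ.+-identityʳ _)
    (≡.trans (≡.trans (List.length-map (_∷ []) (upTo t)) (List.length-upTo t)) (≡.sym (ℕ.*-identityˡ t)))
  length-normals (suc k) with length-normals k
  ... | T , t₀ , h with length-blocks (normals k) (q ℕ.^ k) T t₀ h q
  ... | T′ , h′ = T′ , t₀ ℕ.+ q , h′

  -- The exponent of `z` makes up the missing degree; `suc m` because `normals` bounds the sum
  -- strictly.
  basis : ∀ {k} → ℕ → List (Vec ℕ (suc (suc k)))
  basis {k} m = map (λ u → (m ℕ.∸ Vec.sum u) ∷ u) (normals k (suc m))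

  ∈-basis : ∀ {k m} {e : Vec ℕ (suc (suc k))} → NormalOfDegree m e → e ∈ basis m
  ∈-basis {e = c ∷ u} (nu , ≡.refl) = ≡.subst (λ d → (d ∷ u) ∈ basis (c ℕ.+ Vec.sum u))
    (ℕ.m+n∸n≡m c (Vec.sum u)) (∈-map⁺ _ (∈-normals nu (s≤s (ℕ.m≤n+m (Vec.sum u) c))))

  All-basis : ∀ {k} m → All (NormalOfDegree m) (basis {k} m)
  All-basis {k} m = All.map⁺ (All.map (λ { (nu , s≤s s≤m) → nu , ℕ.m∸n+n≡m s≤m }) (All-normals k (suc m)))

  Unique-basis : ∀ {k} m → Unique (basis {k} m)
  Unique-basis {k} m = Unique.map⁺ Vec.∷-injectiveʳ (Unique-normals k (suc m))

  length-basis : ∀ {k} m → length (basis {k} m) ≡ length (normals k (suc m))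
  length-basis {k} m = List.length-map _ (normals k (suc m))

  -- The weight ignores `z`, but within one degree the exponent of `z` is determined by the others.
  basis-weight-injective : ∀ {k} m (i j : Fin (length (basis {k} m))) → weight (Vec.tail (List.lookup (basis {k} m) i)) ≡
                           weight (Vec.tail (List.lookup (basis {k} m) j)) → i ≡ j
  basis-weight-injective {k} m i j eq = lookup-injective (Unique-basis {k} m) i j
    (tail-injective (All.lookup (All-basis {k} m) (∈-lookup i)) (All.lookup (All-basis {k} m) (∈-lookup j)) eq)
    where
    tail-injective : ∀ {e e′ : Vec ℕ (suc (suc k))} → NormalOfDegree m e → NormalOfDegree m e′ →
                     weight (Vec.tail e) ≡ weight (Vec.tail e′) → e ≡ e′
    tail-injective {c ∷ u} {c′ ∷ u′} (nu , s) (nu′ , s′) eq with weight-injective nu nu′ eq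
    ... | ≡.refl = ≡.cong (_∷ u) (ℕ.+-cancelʳ-≡ (Vec.sum u) c c′ (≡.trans s (≡.sym s′)))

-- Coefficients, homogeneous components and evaluation of polynomials.

module Polynomials (F : Field) where

  open Curves F using (Poly; Exponent; coeff; _≋_; _-ₚ_; _·ₚ_; linComb; component; Homogeneous)
  private module F = Field F
  open RingProperties F.ring using () renaming (-0#≈0# to -0≈0; -‿+-comm to -‿+)

  private
    _≟ᵉ_ : ∀ {v} → DecidableEquality (Vec ℕ v)
    _≟ᵉ_ = Vec.≡-dec ℕ._≟_

  module _ {v : ℕ} where

    private
      Term : Set
      Term = F.Carrier × Exponent v

    restrict : ∀ {K : Set} → DecidableEquality K → (Exponent v → K) → K → Poly v → Poly v
    restrict _≟_ κ k = filter (λ t → κ (proj₂ t) ≟ k)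

    coeff-++ : ∀ (f g : Poly v) e → coeff (f ++ g) e F.≈ coeff f e F.+ coeff g e
    coeff-++ []             g e = F.sym (F.+-identityˡ _)
    coeff-++ ((c , e′) ∷ f) g e with does (e′ ≟ᵉ e)
    ... | true  = F.trans (F.+-congˡ (coeff-++ f g e)) (F.sym (F.+-assoc _ _ _))
    ... | false = coeff-++ f g e

    coeff-neg : ∀ (f : Poly v) e → coeff (map (map₁ (λ c → F.- c)) f) e F.≈ F.- coeff f e
    coeff-neg []             e = F.sym -0≈0
    coeff-neg ((c , e′) ∷ f) e with does (e′ ≟ᵉ e)
    ... | true  = F.trans (F.+-congˡ (coeff-neg f e)) (-‿+ c _)
    ... | false = coeff-neg f e

    coeff-component : ∀ m (f : Poly v) e → Vec.sum e ≡ m → coeff (component m f) e ≡ coeff f e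
    coeff-component m []             e s = ≡.refl
    coeff-component m ((c , e′) ∷ f) e s with Vec.sum e′ ℕ.≟ m
    ... | yes s′ rewrite List.filter-accept (λ t → Vec.sum (proj₂ t) ℕ.≟ m) {x = c , e′} {xs = f} s′ with does (e′ ≟ᵉ e)
    ...   | true  = ≡.cong (c F.+_) (coeff-component m f e s)
    ...   | false = coeff-component m f e s
    coeff-component m ((c , e′) ∷ f) e s | no s′≢ rewrite List.filter-reject (λ t → Vec.sum (proj₂ t) ℕ.≟ m) {x = c , e′} {xs = f} s′≢ with e′ ≟ᵉ e
    ...   | yes ≡.refl = contradiction s s′≢
    ...   | no  _      = coeff-component m f e s

    coeff-component-≢ : ∀ m (f : Poly v) e → Vec.sum e ≢ m → coeff (component m f) e ≡ F.0#
    coeff-component-≢ m []             e s = ≡.refl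
    coeff-component-≢ m ((c , e′) ∷ f) e s with Vec.sum e′ ℕ.≟ m
    ... | no  s′≢ rewrite List.filter-reject (λ t → Vec.sum (proj₂ t) ℕ.≟ m) {x = c , e′} {xs = f} s′≢ = coeff-component-≢ m f e s
    ... | yes s′ rewrite List.filter-accept (λ t → Vec.sum (proj₂ t) ℕ.≟ m) {x = c , e′} {xs = f} s′ with e′ ≟ᵉ e
    ...   | yes ≡.refl = contradiction s′ s
    ...   | no  _      = coeff-component-≢ m f e s

    homogeneous-component : ∀ {m} {f : Poly v} → Homogeneous m f → f ≋ component m f
    homogeneous-component {m} {f} hom e with Vec.sum e ℕ.≟ m
    ... | yes s = F.reflexive (≡.sym (coeff-component m f e s))
    ... | no  s = F.trans (hom e s) (F.reflexive (≡.sym (coeff-component-≢ m f e s)))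

    component-cong : ∀ m {f g : Poly v} → f ≋ g → component m f ≋ component m g
    component-cong m {f} {g} f≋g e with Vec.sum e ℕ.≟ m
    ... | yes s = F.trans (F.reflexive (coeff-component m f e s))
                 (F.trans (f≋g e) (F.reflexive (≡.sym (coeff-component m g e s))))
    ... | no  s = F.reflexive (≡.trans (coeff-component-≢ m f e s) (≡.sym (coeff-component-≢ m g e s)))

    component-all : ∀ m (f : Poly v) → All (λ t → Vec.sum (proj₂ t) ≡ m) f → component m f ≡ f
    component-all m f = List.filter-all _

    All-component : ∀ m (f : Poly v) → All (λ t → Vec.sum (proj₂ t) ≡ m) (component m f)
    All-component m f = All.all-filter _ f

    All⇒Homogeneous : ∀ {m} {f : Poly v} → All (λ t → Vec.sum (proj₂ t) ≡ m) f → Homogeneous m f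
    All⇒Homogeneous {m} {f} all e e≢m = F.reflexive (≡.trans
      (≡.cong (λ g → coeff g e) (≡.sym (component-all m f all))) (coeff-component-≢ m f e e≢m))

    component-component : ∀ m (f : Poly v) → component m (component m f) ≡ component m f
    component-component m f = component-all m (component m f) (All-component m f)

    component-component-≢ : ∀ m m′ (f : Poly v) → m ≢ m′ → component m (component m′ f) ≡ []
    component-component-≢ m m′ f m≢m′ = List.filter-none _
      (All.map (λ s s′ → m≢m′ (≡.trans (≡.sym s′) s)) (All-component m′ f))

    component-bound : ∀ (f : Poly v) → ∃ λ b → ∀ m → b ℕ.≤ m → component m f ≡ []
    component-bound [] = 0 , λ m _ → ≡.refl
    component-bound ((c , e) ∷ f) with component-bound f
    ... | b , h = suc (Vec.sum e) ℕ.+ b , λ m b≤m → ≡.trans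
      (List.filter-reject (λ t → Vec.sum (proj₂ t) ℕ.≟ m) {x = (c , e)} {xs = f}
        λ eq → ℕ.<-irrefl eq (ℕ.≤-trans (ℕ.m≤m+n (suc (Vec.sum e)) b) b≤m))
      (h m (ℕ.≤-trans (ℕ.m≤n+m b _) b≤m))

  module Evaluation (A : CommutativeRing 0ℓ 0ℓ) (ι : F.Carrier → CommutativeRing.Carrier A)
                    (ι-homo : IsRingHomomorphism F.rawRing (CommutativeRing.rawRing A) ι) where

    open CommutativeRing A hiding (zero)
    open Monomial A
    open IsRingHomomorphism ι-homo using (+-homo; *-homo; 0#-homo; 1#-homo; -‿homo) renaming (⟦⟧-cong to ι-cong)
    open RingProperties ring using (-‿+-comm; -0#≈0#; -‿distribˡ-*)
    open Sum semiring using (sum; sum-cong-≋)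
    open CommutativeSemigroupProperties +-commutativeSemigroup using (x∙yz≈y∙xz)

    evaluate : ∀ {v} → Poly v → (Fin v → Carrier) → Carrier
    evaluate []            x = 0#
    evaluate ((c , e) ∷ f) x = ι c * monomial x e + evaluate f x

    module _ {v : ℕ} (x : Fin v → Carrier) where

      evaluate-++ : ∀ (f g : Poly v) → evaluate (f ++ g) x ≈ evaluate f x + evaluate g x
      evaluate-++ []      g = sym (+-identityˡ _)
      evaluate-++ (t ∷ f) g = trans (+-congˡ (evaluate-++ f g)) (sym (+-assoc _ _ _))

      evaluate-neg : ∀ (f : Poly v) → evaluate (map (map₁ (λ c → F.- c)) f) x ≈ - evaluate f x
      evaluate-neg []            = sym -0#≈0#
      evaluate-neg ((c , e) ∷ f) = trans
        (+-cong (trans (*-congʳ (-‿homo c)) (sym (-‿distribˡ-* _ _))) (evaluate-neg f)) (-‿+-comm _ _)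

      evaluate-- : ∀ (f g : Poly v) → evaluate (f -ₚ g) x ≈ evaluate f x + - evaluate g x
      evaluate-- f g = trans (evaluate-++ f _) (+-congˡ (evaluate-neg g))

      evaluate-· : ∀ a (f : Poly v) → evaluate (a ·ₚ f) x ≈ ι a * evaluate f x
      evaluate-· a []            = sym (zeroʳ _)
      evaluate-· a ((c , e) ∷ f) = trans
        (+-cong (trans (*-congʳ (*-homo a c)) (*-assoc _ _ _)) (evaluate-· a f)) (sym (distribˡ _ _ _))

      evaluate-linComb : ∀ {k} (a : Fin k → F.Carrier) (b : Fin k → Poly v) →
                         evaluate (linComb a b) x ≈ sum (λ i → ι (a i) * evaluate (b i) x)
      evaluate-linComb {zero}  a b = refl
      evaluate-linComb {suc k} a b = trans (evaluate-++ (a zero ·ₚ b zero) _)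
        (+-cong (evaluate-· (a zero) (b zero)) (evaluate-linComb (a ∘ suc) (b ∘ suc)))

      private
        evaluate-split : ∀ {P : F.Carrier × Exponent v → Set} (P? : Unary.Decidable P) (f : Poly v) →
                         evaluate f x ≈ evaluate (filter P? f) x + evaluate (filter (¬? ∘ P?) f) x
        evaluate-split P? [] = sym (+-identityˡ 0#)
        evaluate-split P? (t ∷ f) with P? t
        ... | yes _ = trans (+-congˡ (evaluate-split P? f)) (sym (+-assoc _ _ _))
        ... | no  _ = trans (+-congˡ (evaluate-split P? f)) (x∙yz≈y∙xz _ _ _)

      module _ {K : Set} (_≟_ : DecidableEquality K) (κ : Exponent v → K) where

        private
          restrict-other : ∀ k k′ (f : Poly v) → k ≢ k′ →
            restrict _≟_ κ k (filter (λ t → ¬? (κ (proj₂ t) ≟ k′)) f) ≡ restrict _≟_ κ k f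
          restrict-other k k′ [] k≢k′ = ≡.refl
          restrict-other k k′ (t ∷ f) k≢k′ with κ (proj₂ t) ≟ k′
          ... | yes eq = ≡.trans (restrict-other k k′ f k≢k′)
                (≡.sym (List.filter-reject (λ t → κ (proj₂ t) ≟ k) {x = t} {xs = f} λ eq′ → k≢k′ (≡.trans (≡.sym eq′) eq)))
          ... | no  _ with κ (proj₂ t) ≟ k
          ...   | yes _ = ≡.cong (t ∷_) (restrict-other k k′ f k≢k′)
          ...   | no  _ = restrict-other k k′ f k≢k′

          restrict-same : ∀ k (f : Poly v) → restrict _≟_ κ k (filter (λ t → ¬? (κ (proj₂ t) ≟ k)) f) ≡ []
          restrict-same k f = List.filter-none _ (All.all-filter (λ t → ¬? (κ (proj₂ t) ≟ k)) f)

          -- All terms that share the key of the first one are removed at once; the length bound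
          -- replaces structural recursion, since the remainder is a filtered list.
          vanish : ∀ b (f : Poly v) → length f ℕ.≤ b →
                   (∀ k → evaluate (restrict _≟_ κ k f) x ≈ 0#) → evaluate f x ≈ 0#
          vanish b       []        f≤b h = refl
          vanish (suc b) f@(t ∷ f′) (s≤s f≤b) h = trans (evaluate-split (λ t → κ (proj₂ t) ≟ k) f)
            (trans (+-cong (h k) (vanish b rest rest≤b h-rest)) (+-identityˡ 0#))
            where
            k = κ (proj₂ t)
            rest = filter (λ t → ¬? (κ (proj₂ t) ≟ k)) f
            rest≤b : length rest ℕ.≤ b
            rest≤b = ≡.subst (λ g → length g ℕ.≤ b)
              (≡.sym (List.filter-reject (λ t → ¬? (κ (proj₂ t) ≟ k)) {x = t} {xs = f′} λ ¬eq → ¬eq ≡.refl))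
              (ℕ.≤-trans (List.length-filter _ f′) f≤b)
            h-rest : ∀ k′ → evaluate (restrict _≟_ κ k′ rest) x ≈ 0#
            h-rest k′ with k′ ≟ k
            ... | yes ≡.refl = reflexive (≡.cong (λ g → evaluate g x) (restrict-same k f))
            ... | no  k′≢k   = trans (reflexive (≡.cong (λ g → evaluate g x) (restrict-other k′ k f k′≢k))) (h k′)

        -- With the exponent as key this yields invariance under equality of coefficients, with the
        -- degree as key the reduction to homogeneous components.
        evaluate-vanish : ∀ f → (∀ k → evaluate (restrict _≟_ κ k f) x ≈ 0#) → evaluate f x ≈ 0#
        evaluate-vanish f = vanish (length f) f ℕ.≤-refl

      private
        evaluate-restrict : ∀ f e → evaluate (restrict _≟ᵉ_ id e f) x ≈ ι (coeff f e) * monomial x e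
        evaluate-restrict [] e = sym (trans (*-congʳ 0#-homo) (zeroˡ _))
        evaluate-restrict ((c , e′) ∷ f) e with e′ ≟ᵉ e
        ... | yes ≡.refl = trans (+-congˡ (evaluate-restrict f e))
              (trans (sym (distribʳ _ _ _)) (*-congʳ (sym (+-homo c _))))
        ... | no  _      = evaluate-restrict f e

      evaluate-cong : ∀ {f g : Poly v} → f ≋ g → evaluate f x ≈ evaluate g x
      evaluate-cong {f} {g} f≋g = begin
        evaluate f x                                       ≈⟨ +-identityʳ _ ⟨
        evaluate f x + 0#                                  ≈⟨ +-congˡ (-‿inverseˡ _) ⟨
        evaluate f x + (- evaluate g x + evaluate g x)     ≈⟨ +-assoc _ _ _ ⟨
        evaluate f x + - evaluate g x + evaluate g x       ≈⟨ +-congʳ (evaluate-- f g) ⟨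
        evaluate (f -ₚ g) x + evaluate g x                 ≈⟨ +-congʳ f-g≈0 ⟩
        0# + evaluate g x                                  ≈⟨ +-identityˡ _ ⟩
        evaluate g x                                       ∎
        where
        open SetoidReasoning setoid
        f-g≈0 : evaluate (f -ₚ g) x ≈ 0#
        f-g≈0 = evaluate-vanish _≟ᵉ_ id (f -ₚ g) λ e → trans (evaluate-restrict (f -ₚ g) e)
          (trans (*-congʳ (trans (ι-cong (F.trans (coeff-++ f _ e) (F.trans (F.+-congˡ (coeff-neg g e))
            (F.trans (F.+-congʳ (f≋g e)) (F.-‿inverseʳ _))))) 0#-homo)) (zeroˡ _))

      evaluate-vanish-components : ∀ f → (∀ m → evaluate (component m f) x ≈ 0#) → evaluate f x ≈ 0#
      evaluate-vanish-components = evaluate-vanish ℕ._≟_ Vec.sum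

module FieldProperties (F : Field) where

  open Field F

  *-nonzero : ∀ {x y} → ¬ (x ≈ 0#) → ¬ (y ≈ 0#) → ¬ (x * y ≈ 0#)
  *-nonzero {x} {y} x≉0 y≉0 xy≈0 with inverse x x≉0
  ... | x⁻¹ , xx⁻¹≈1 = y≉0 (begin
    y              ≈⟨ *-identityˡ y ⟨
    1# * y         ≈⟨ *-congʳ (trans (*-comm x⁻¹ x) xx⁻¹≈1) ⟨
    x⁻¹ * x * y    ≈⟨ *-assoc x⁻¹ x y ⟩
    x⁻¹ * (x * y)  ≈⟨ *-congˡ xy≈0 ⟩
    x⁻¹ * 0#       ≈⟨ zeroʳ x⁻¹ ⟩
    0#             ∎)
    where open SetoidReasoning setoid

-- Independence of the reduced monomials on the branch.

module Tower (F : Field) (_≟_ : Decidable (Field._≈_ F)) (p : ℕ) (0<p : 0 ℕ.< p) (n : ℕ) where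

  private module F = Field F
  open Curves F using (Poly; Exponent)
  open Polynomials F
  open Normalisation p
  open Weight p
  open NormalMonomials p
  module S = PowerSeries F.commutativeRing
  private module SR = CommutativeRing S.commutativeRing
  open Parametrisation F.commutativeRing p 0<p using (branch; branch-monic)
  open Monomial using (monomial; sumOver)

  module Basis (m : ℕ) where

    exponents : List (Exponent (suc (suc n)))
    exponents = basis m

    Coefficients : Set
    Coefficients = Fin (length exponents) → F.Carrier

    module Combination (A : CommutativeRing 0ℓ 0ℓ) (ι : F.Carrier → CommutativeRing.Carrier A)
                       (x : Fin (suc (suc n)) → CommutativeRing.Carrier A) where

      open CommutativeRing A
      open Sum semiring using (sum)

      combination : Coefficients → Carrier
      combination a = sum (λ i → ι (a i) * monomial A x (List.lookup exponents i))

    private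
      sum-updateAt : ∀ (A : CommutativeRing 0ℓ 0ℓ) ι → IsRingHomomorphism F.rawRing (CommutativeRing.rawRing A) ι →
        let open CommutativeRing A in let open Sum semiring using (sum) in
        ∀ {k} (b : Fin k → Carrier) c i (a : Fin k → F.Carrier) →
        sum (λ j → ι (updateAt a i (c F.+_) j) * b j) ≈ ι c * b i + sum (λ j → ι (a j) * b j)
      sum-updateAt A ι ι-homo b c zero a = trans
        (+-congʳ (trans (*-congʳ (+-homo c (a zero))) (distribʳ _ _ _))) (+-assoc _ _ _)
        where
        open CommutativeRing A hiding (zero)
        open IsRingHomomorphism ι-homo using (+-homo)
      sum-updateAt A ι ι-homo b c (suc i) a =
        trans (+-congˡ (sum-updateAt A ι ι-homo (b ∘ suc) c i (a ∘ suc))) (x∙yz≈y∙xz _ _ _)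
        where
        open CommutativeRing A hiding (zero)
        open CommutativeSemigroupProperties +-commutativeSemigroup using (x∙yz≈y∙xz)

      add-monomials : ∀ c es → All (NormalOfDegree m) es → (a : Coefficients) → Σ Coefficients λ a′ →
        ∀ A ι → IsRingHomomorphism F.rawRing (CommutativeRing.rawRing A) ι → ∀ x →
        let open CommutativeRing A in let open Combination A ι x in
        combination a′ ≈ ι c * sumOver A x es + combination a
      add-monomials c [] [] a = a , λ A ι ι-homo x → let open CommutativeRing A in
        sym (trans (+-congʳ (zeroʳ _)) (+-identityˡ _))
      add-monomials c (e ∷ es) (normal ∷ normals) a with add-monomials c es normals a
      ... | a′ , h = updateAt a′ i (c F.+_) , λ A ι ι-homo x →
        let open CommutativeRing A in
        trans (sum-updateAt A ι ι-homo _ c i a′)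
       (trans (+-cong (*-congˡ (reflexive (≡.cong (monomial A x) (≡.sym (Any.lookup-index e∈))))) (h A ι ι-homo x))
       (trans (sym (+-assoc _ _ _)) (+-congʳ (sym (distribˡ _ _ _)))))
        where
        e∈ = ∈-basis {e = e} normal
        i  = Any.index e∈

    combination-zero : ∀ A ι → IsRingHomomorphism F.rawRing (CommutativeRing.rawRing A) ι → ∀ x {a} →
      (∀ i → a i F.≈ F.0#) → let open CommutativeRing A in Combination.combination A ι x a ≈ 0#
    combination-zero A ι ι-homo x a≈0 =
      trans (sum-cong-≋ {length exponents} λ i → trans (*-congʳ (trans (⟦⟧-cong (a≈0 i)) 0#-homo)) (zeroˡ _))
            (sum-replicate-zero (length exponents))
      where
      open CommutativeRing A
      open IsRingHomomorphism ι-homo using (0#-homo; ⟦⟧-cong)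
      open Sum semiring using (sum-cong-≋; sum-replicate-zero)

    -- One vector over F for all rings: what is proved about it over F[[X]] can be used at points
    -- over F.
    coefficients : ∀ (f : Poly (suc (suc n))) → All (λ t → Vec.sum (proj₂ t) ≡ m) f → Σ Coefficients λ a →
      ∀ A ι (ι-homo : IsRingHomomorphism F.rawRing (CommutativeRing.rawRing A) ι) x → OnCurve A x →
      let open CommutativeRing A in let open Combination A ι x in let open Evaluation A ι ι-homo in
      evaluate f x ≈ combination a
    coefficients [] [] = (λ _ → F.0#) , λ A ι ι-homo x on →
      CommutativeRing.sym A (combination-zero A ι ι-homo x λ i → F.refl)
    coefficients ((c , e) ∷ f) (≡.refl ∷ homog) with coefficients f homog | normalForm 0<p e
    ... | a , h | es , normal , value with add-monomials c es normal a
    ... | a′ , h′ = a′ , λ A ι ι-homo x on →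
      let open CommutativeRing A in
      sym (trans (h′ A ι ι-homo x) (+-cong (*-congˡ (sym (value A x on))) (sym (h A ι ι-homo x on))))

    open Combination S.commutativeRing S.constant (branch n) public

    private
      expansion : Fin (length exponents) → S.Series
      expansion i = monomial S.commutativeRing (branch n) (List.lookup exponents i)

      order : Fin (length exponents) → ℕ
      order i = weight (Vec.tail (List.lookup exponents i))

      open Sum F.semiring using (sum)

      sum-concentrated : ∀ {k} (t : Fin k → F.Carrier) i → (∀ j → j ≢ i → t j F.≈ F.0#) → sum t F.≈ t i
      sum-concentrated {suc k} t zero h = F.trans (F.+-congˡ (F.trans (Fsum-cong λ j → h (suc j) λ ()) (Fsum-zero k))) (F.+-identityʳ _)
        where open Sum F.semiring using () renaming (sum-cong-≋ to Fsum-cong; sum-replicate-zero to Fsum-zero)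
      sum-concentrated t (suc i) h = F.trans (F.+-cong (h zero λ ()) (sum-concentrated (t ∘ suc) i λ j j≢i → h (suc j) (j≢i ∘ Fin.suc-injective)))
                                       (F.+-identityˡ _)

      combination-at : ∀ a k → combination a k F.≈ sum (λ i → a i F.* expansion i k)
      combination-at a k = at-sum _ _ λ i → S.constant-*ₛ (a i) (expansion i) k
        where
        open Sum SR.semiring using () renaming (sum to Ssum)
        at-sum : ∀ {l} (t : Fin l → S.Series) (u : Fin l → F.Carrier) → (∀ i → t i k F.≈ u i) → Ssum t k F.≈ sum u
        at-sum {zero}  t u h = F.refl
        at-sum {suc l} t u h = F.+-cong (h zero) (at-sum (t ∘ suc) (u ∘ suc) (h ∘ suc))

      VanishingBelow : Coefficients → ℕ → Set
      VanishingBelow a k = ∀ i → order i ℕ.< k → a i F.≈ F.0#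

      -- In degree `k` the expansions of higher order contribute nothing, those of lower order have
      -- coefficient zero, and at most one has order `k`.
      combination-leading : ∀ a k → VanishingBelow a k → ∀ i → order i ≡ k → combination a k F.≈ a i
      combination-leading a k a-k i ≡.refl = F.trans (combination-at a k) (F.trans (sum-concentrated _ i others)
        (F.trans (F.*-congˡ (proj₂ (branch-monic n (List.lookup exponents i)))) (F.*-identityʳ _)))
        where
        others : ∀ j → j ≢ i → a j F.* expansion j k F.≈ F.0#
        others j j≢i with ℕ.<-cmp (order j) k
        ... | tri< j<k _ _ = F.trans (F.*-congʳ (a-k j j<k)) (F.zeroˡ _)
        ... | tri≈ _ j≡k _ = contradiction (basis-weight-injective {n} m j i j≡k) j≢i
        ... | tri> _ _ k<j = F.trans (F.*-congˡ (proj₁ (branch-monic n (List.lookup exponents j)) k k<j)) (F.zeroʳ _)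

      -- Going upwards, the coefficient of the basis element of order `k`, if there is one, is also
      -- coefficient `k` of the combination, and whether it is zero can be decided in F.
      scan : ∀ a k → VanishingBelow a k ⊎ ∃ λ l → ¬ (combination a l F.≈ F.0#)
      scan a zero = inj₁ (λ i ())
      scan a (suc k) with scan a k
      ... | inj₂ found = inj₂ found
      ... | inj₁ a-k with Fin.any? (λ i → order i ℕ.≟ k)
      ...   | no  none = inj₁ λ i i≤k → a-k i (ℕ.≤∧≢⇒< (ℕ.≤-pred i≤k) λ eq → none (i , eq))
      ...   | yes (i , i≡k) with a i ≟ F.0#
      ...     | no  ai≉0 = inj₂ (k , λ eq → ai≉0 (F.trans (F.sym (combination-leading a k a-k i i≡k)) eq))
      ...     | yes ai≈0 = inj₁ extend
        where
        extend : VanishingBelow a (suc k)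
        extend j j≤k with ℕ.m<1+n⇒m<n∨m≡n j≤k
        ... | inj₁ j<k = a-k j j<k
        ... | inj₂ j≡k = F.trans (F.reflexive (≡.cong a (basis-weight-injective {n} m j i (≡.trans j≡k (≡.sym i≡k))))) ai≈0

      bound : ∀ {k} (f : Fin k → ℕ) → ∃ λ b → ∀ i → f i ℕ.< b
      bound {zero}  f = 0 , λ ()
      bound {suc k} f with bound (f ∘ suc)
      ... | b , h = suc (f zero) ℕ.+ b , λ
        { zero    → ℕ.m≤m+n _ b
        ; (suc i) → ℕ.<-≤-trans (h i) (ℕ.m≤n+m b _) }

    -- The expansions of the basis have distinct orders, so the lowest one with a
    -- nonzero coefficient cannot be cancelled.
    zero-or-nonzero : ∀ a → (∀ i → a i F.≈ F.0#) ⊎ ∃ λ k → ¬ (combination a k F.≈ F.0#)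
    zero-or-nonzero a with bound order
    ... | b , order<b with scan a b
    ...   | inj₁ a-b   = inj₁ λ i → a-b i (order<b i)
    ...   | inj₂ found = inj₂ found

    independent : ∀ a → combination a S.≈ₛ S.0ₛ → ∀ i → a i F.≈ F.0#
    independent a a≈0 with zero-or-nonzero a
    ... | inj₁ all≈0    = all≈0
    ... | inj₂ (k , ≉0) = contradiction (S.at a≈0 k) ≉0

-- The homogeneous prime ideal of the branch.

module TowerCurve (F : Field) (_≟_ : Decidable (Field._≈_ F)) (p : ℕ) (0<p : 0 ℕ.< p) (n : ℕ) where

  open Tower F _≟_ p 0<p n
  private module F = Field F
  open Curves F using (Poly; Exponent; eval; linComb; component; Homogeneous; _≋_; _*ₚ_; _-ₚ_; 1ₚ;
                       IsIdeal; IsHomogeneousPrime; HilbertFunction; IrreducibleCurve)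
  open FieldProperties F using (*-nonzero)
  open Polynomials F
  open Normalisation p
  open NormalMonomials p
  open Monomial using (monomial; monomial-⊕; monomial-single)
  open Parametrisation F.commutativeRing p 0<p using (branch; branch-onCurve)

  private
    module SR = CommutativeRing S.commutativeRing
    module SE = Evaluation S.commutativeRing S.constant S.constant-homo
    module G = PowerSeries S.commutativeRing
    module GR = CommutativeRing G.commutativeRing

    v : ℕ
    v = suc (suc n)

  -- graded f is the power series f (s · branch) in s, hence multiplicative in f.
  graded : Poly v → G.Series
  graded f m = SE.evaluate (component m f) (branch n)

  -- Imposed on each component separately, because terms of different degrees may cancel on the
  -- branch: `z - 1` vanishes there.
  ideal : Poly v → Set
  ideal f = ∀ m → graded f m S.≈ₛ S.0ₛ

  private
    gradedTerm : F.Carrier × Exponent v → G.Series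
    gradedTerm (c , e) = G.monomialₛ (Vec.sum e) (S.constant c S.*ₛ monomial S.commutativeRing (branch n) e)

    gradedTerm-* : ∀ t u → GR._≈_ (gradedTerm (zip F._*_ _⊕_ t u)) (gradedTerm t G.*ₛ gradedTerm u)
    gradedTerm-* (c , e) (c′ , e′) = G.pointwise λ m → SR.trans
      (SR.reflexive (≡.cong (λ d → G.monomialₛ d (S.constant (c F.* c′) S.*ₛ monomial S.commutativeRing (branch n) (e ⊕ e′)) m) (sum-⊕ e e′)))
      (SR.trans (G.monomialₛ-cong (Vec.sum e ℕ.+ Vec.sum e′) product m)
                (G.monomialₛ-* (Vec.sum e) (Vec.sum e′) _ _ m))
      where
      open IsRingHomomorphism S.constant-homo using (*-homo)
      open CommutativeSemigroupProperties SR.*-commutativeSemigroup using (interchange)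
      product = SR.trans (SR.*-cong (*-homo c c′) (monomial-⊕ S.commutativeRing (branch n) e e′)) (interchange _ _ _ _)

    graded-∷ : ∀ t f m → graded (t ∷ f) m S.≈ₛ gradedTerm t m S.+ₛ graded f m
    graded-∷ (c , e) f m with Vec.sum e ℕ.≟ m
    ... | yes ≡.refl rewrite List.filter-accept (λ t → Vec.sum (proj₂ t) ℕ.≟ m) {x = c , e} {xs = f} ≡.refl =
      SR.+-congʳ (SR.sym (G.monomialₛ-≡ (Vec.sum e) _))
    ... | no  s≢m    rewrite List.filter-reject (λ t → Vec.sum (proj₂ t) ℕ.≟ m) {x = c , e} {xs = f} s≢m =
      SR.sym (SR.trans (SR.+-congʳ (G.monomialₛ-≢ (Vec.sum e) _ m s≢m)) (SR.+-identityˡ _))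

    graded-++ : ∀ f g m → graded (f ++ g) m S.≈ₛ graded f m S.+ₛ graded g m
    graded-++ f g m = SR.trans
      (SR.reflexive (≡.cong (λ h → SE.evaluate h (branch n)) (List.filter-++ (λ t → Vec.sum (proj₂ t) ℕ.≟ m) f g)))
      (SE.evaluate-++ (branch n) (component m f) (component m g))

    graded-map : ∀ t g → GR._≈_ (graded (map (zip F._*_ _⊕_ t) g)) (gradedTerm t G.*ₛ graded g)
    graded-map t []      = GR.sym (GR.trans (GR.*-congˡ {gradedTerm t} {graded []} {GR.0#} (G.pointwise λ m → SR.refl))
                                           (GR.zeroʳ (gradedTerm t)))
    graded-map t (u ∷ g) = GR.trans {j = gradedTerm (zip F._*_ _⊕_ t u) G.+ₛ graded (map (zip F._*_ _⊕_ t) g)}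
      (G.pointwise (graded-∷ (zip F._*_ _⊕_ t u) (map (zip F._*_ _⊕_ t) g)))
      (GR.trans (GR.+-cong (gradedTerm-* t u) (graded-map t g))
      (GR.trans (GR.sym (GR.distribˡ (gradedTerm t) (gradedTerm u) (graded g)))
                (GR.*-congˡ {gradedTerm t} (GR.sym {graded (u ∷ g)} (G.pointwise (graded-∷ u g))))))

    graded-* : ∀ f g → GR._≈_ (graded (f *ₚ g)) (graded f G.*ₛ graded g)
    graded-* []      g = GR.sym (GR.trans (GR.*-congʳ {graded g} {graded []} {GR.0#} (G.pointwise λ m → SR.refl))
                                          (GR.zeroˡ (graded g)))
    graded-* (t ∷ f) g = GR.trans {j = graded (map (zip F._*_ _⊕_ t) g) G.+ₛ graded (f *ₚ g)}
      (G.pointwise (graded-++ (map (zip F._*_ _⊕_ t) g) (f *ₚ g)))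
      (GR.trans (GR.+-cong (graded-map t g) (graded-* f g))
      (GR.trans (GR.sym (GR.distribʳ (graded g) (gradedTerm t) (graded f)))
                (GR.*-congʳ {graded g} (GR.sym {graded (t ∷ f)} (G.pointwise (graded-∷ t f))))))

    isIdeal : IsIdeal ideal
    isIdeal = record
      { resp     = λ {f} {g} f≋g f∈I m → SR.trans
                     (SR.sym (SE.evaluate-cong (branch n) {component m f} {component m g} (component-cong m {f} {g} f≋g))) (f∈I m)
      ; 0-closed = λ m → SR.refl
      ; +-closed = λ {f} {g} f∈I g∈I m → SR.trans (graded-++ f g m)
                     (SR.trans (SR.+-cong (f∈I m) (g∈I m)) (SR.+-identityˡ _))
      ; *-closed = λ f {g} g∈I m → G.at (GR.trans (graded-* f g)
                     (GR.trans (GR.*-congˡ {graded f} {graded g} {GR.0#} (G.pointwise g∈I)) (GR.zeroʳ (graded f)))) m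
      }

  Nonzero : S.Series → Set
  Nonzero f = ∃ λ k → ¬ (f k F.≈ F.0#)

  private
    -- Equality of power series is undecidable in general, but the values of forms of degree `m` are
    -- combinations of a finite independent family, and only their coefficients need to be tested.
    graded-zero-or-nonzero : ∀ f m → graded f m S.≈ₛ S.0ₛ ⊎ Nonzero (graded f m)
    graded-zero-or-nonzero f m = decide (zero-or-nonzero a)
      where
      open Basis m
      coeffs = coefficients (component m f) (All-component m f)
      a = proj₁ coeffs
      expand : graded f m S.≈ₛ combination a
      expand = proj₂ coeffs S.commutativeRing S.constant S.constant-homo (branch n) (branch-onCurve n)
      decide : (∀ i → a i F.≈ F.0#) ⊎ Nonzero (combination a) → graded f m S.≈ₛ S.0ₛ ⊎ Nonzero (graded f m)
      decide (inj₁ a≈0)       = inj₁ (SR.trans expand (combination-zero S.commutativeRing S.constant S.constant-homo (branch n) a≈0))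
      decide (inj₂ (k , ≉0))  = inj₂ (k , λ eq → ≉0 (F.trans (F.sym (S.at expand k)) eq))

    Nonzero₀ : F.Carrier → Set
    Nonzero₀ x = ¬ (x F.≈ F.0#)

    Nonzero₀-resp : ∀ {x y} → x F.≈ y → Nonzero₀ x → Nonzero₀ y
    Nonzero₀-resp x≈y x≉0 y≈0 = x≉0 (F.trans x≈y y≈0)

    module FN = S.Nonzero Nonzero₀ Nonzero₀-resp *-nonzero

    decide₀ : ∀ x → x F.≈ F.0# ⊎ ¬ (x F.≈ F.0#)
    decide₀ x with x ≟ F.0#
    ... | yes x≈0 = inj₁ x≈0
    ... | no  x≉0 = inj₂ x≉0

    Nonzero-resp : ∀ {f g} → f S.≈ₛ g → Nonzero f → Nonzero g
    Nonzero-resp f≈g (k , fk≉0) = k , Nonzero₀-resp (S.at f≈g k) fk≉0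

    Nonzero-* : ∀ {f g} → Nonzero f → Nonzero g → Nonzero (f S.*ₛ g)
    Nonzero-* {f} {g} = FN.*ₛ-nonzero f g (decide₀ ∘ f) (decide₀ ∘ g)

    module SN = G.Nonzero Nonzero Nonzero-resp Nonzero-*

    -- Beyond some degree all components are empty; below it the degrees are tested one by one.
    member-or-nonzero : ∀ f → ideal f ⊎ ∃ λ m → Nonzero (graded f m)
    member-or-nonzero f with component-bound f
    ... | b , vanishes = decide b (λ m b≤m → SR.reflexive (≡.cong (λ h → SE.evaluate h (branch n)) (vanishes m b≤m)))
      where
      decide : ∀ b → (∀ m → b ℕ.≤ m → graded f m S.≈ₛ S.0ₛ) → ideal f ⊎ ∃ λ m → Nonzero (graded f m)
      decide zero    h = inj₁ λ m → h m z≤n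
      decide (suc b) h with graded-zero-or-nonzero f b
      ... | inj₂ nonzero = inj₂ (b , nonzero)
      ... | inj₁ fb≈0    = decide b lower
        where
        lower : ∀ m → b ℕ.≤ m → graded f m S.≈ₛ S.0ₛ
        lower m b≤m with ℕ.m≤n⇒m<n∨m≡n b≤m
        ... | inj₁ b<m    = h m b<m
        ... | inj₂ ≡.refl = fb≈0

  isHomogeneousPrime : IsHomogeneousPrime ideal
  isHomogeneousPrime = record
    { isIdeal     = isIdeal
    ; homogeneous = λ {f} f∈I m m′ → homogeneous f f∈I m m′
    ; proper      = λ 1∈I → F.1≉0 (S.at (SR.trans (SR.sym one) (1∈I 0)) 0)
    ; prime       = prime
    }
    where
    homogeneous : ∀ f → ideal f → ∀ m m′ → graded (component m f) m′ S.≈ₛ S.0ₛ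
    homogeneous f f∈I m m′ with m′ ℕ.≟ m
    ... | yes ≡.refl = SR.trans (SR.reflexive (≡.cong (λ h → SE.evaluate h (branch n)) (component-component m f))) (f∈I m)
    ... | no  m′≢m   = SR.reflexive (≡.cong (λ h → SE.evaluate h (branch n)) (component-component-≢ m′ m f m′≢m))

    one : graded (1ₚ {v}) 0 S.≈ₛ S.1ₛ
    one = SR.trans (SR.reflexive (≡.cong (λ h → SE.evaluate h (branch n))
                     (component-all 0 (1ₚ {v}) (sum-zeros v ∷ []))))
         (SR.trans (SR.+-identityʳ _) (SR.trans (SR.*-identityˡ _) (Monomial.monomial-zeros S.commutativeRing (branch n))))

    -- The disjunction comes from testing `f` and `g` themselves. The product serves only to refute
    -- the case that both lie outside.
    prime : ∀ f g → ideal (f *ₚ g) → ideal f ⊎ ideal g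
    prime f g fg∈I = decide (member-or-nonzero f) (member-or-nonzero g)
      where
      fg≈0 : GR._≈_ (graded f G.*ₛ graded g) GR.0#
      fg≈0 = GR.trans (GR.sym (graded-* f g)) (G.pointwise fg∈I)

      decide : ideal f ⊎ (∃ λ m → Nonzero (graded f m)) → ideal g ⊎ (∃ λ m → Nonzero (graded g m)) → ideal f ⊎ ideal g
      decide (inj₁ f∈I) _          = inj₁ f∈I
      decide (inj₂ _)   (inj₁ g∈I) = inj₂ g∈I
      decide (inj₂ f≉0) (inj₂ g≉0) =
        let m , k , ≉0 = SN.*ₛ-nonzero (graded f) (graded g) (graded-zero-or-nonzero f) (graded-zero-or-nonzero g) f≉0 g≉0
        in contradiction (S.at (G.at fg≈0 m) k) ≉0

  private
    evaluates-to-zero : ∀ {m} {f : Poly v} → Homogeneous m f → SE.evaluate f (branch n) S.≈ₛ S.0ₛ → ideal f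
    evaluates-to-zero {m} {f} hom f≈0 m′ with m′ ℕ.≟ m
    ... | yes ≡.refl = SR.trans (SR.sym (SE.evaluate-cong (branch n) {f} {component m f} (homogeneous-component {f = f} hom))) f≈0
    ... | no  m′≢m   = SE.evaluate-cong (branch n) {component m′ f} {[]} component≋0
      where
      component≋0 : component m′ f ≋ []
      component≋0 e with Vec.sum e ℕ.≟ m′
      ... | no  s≢m′   = F.reflexive (coeff-component-≢ m′ f e s≢m′)
      ... | yes s≡m′   = F.trans (F.reflexive (coeff-component m′ f e s≡m′)) (hom e λ s≡m → m′≢m (≡.trans (≡.sym s≡m′) s≡m))

  -- Hilbert function and degree.

  hilbertFunction : ∀ m → HilbertFunction ideal m (length (Basis.exponents m))
  hilbertFunction m = b , (λ i → All⇒Homogeneous {m = m} {f = b i} (degree-b i ∷ [])) , spans , λ a lc∈I →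
    independent a (SR.trans (SR.sym (evaluate-linComb′ a)) (SR.trans
      (SR.reflexive (≡.cong (λ h → SE.evaluate h (branch n)) (≡.sym (component-all m (linComb a b) (All-linComb a))))) (lc∈I m)))
    where
    open Basis m
    b : Fin (length exponents) → Poly v
    b i = (F.1# , List.lookup exponents i) ∷ []

    degree-b : ∀ i → Vec.sum (List.lookup exponents i) ≡ m
    degree-b i = proj₂ (All.lookup (All-basis {n} m) (∈-lookup i))

    All-linComb : ∀ a → All (λ t → Vec.sum (proj₂ t) ≡ m) (linComb a b)
    All-linComb a = All.concat⁺ (All.tabulate⁺ (λ i → degree-b i ∷ []))

    evaluate-linComb′ : ∀ a → SE.evaluate (linComb a b) (branch n) S.≈ₛ combination a
    evaluate-linComb′ a = SR.trans (SE.evaluate-linComb (branch n) a b)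
      (sum-cong-≋ {length exponents} λ i → SR.*-congˡ (b-value i))
      where
      open Sum SR.semiring using (sum-cong-≋)
      b-value : ∀ i → SE.evaluate (b i) (branch n) S.≈ₛ monomial S.commutativeRing (branch n) (List.lookup exponents i)
      b-value i = SR.trans (SR.+-identityʳ _) (SR.*-identityˡ _)

    spans : ∀ f → Homogeneous m f → ∃ λ a → ideal (f -ₚ linComb a b)
    spans f hom = a , evaluates-to-zero {m} {f -ₚ linComb a b} difference-homogeneous
      (SR.trans (SE.evaluate-- (branch n) f (linComb a b)) (SR.trans (SR.+-cong expand (SR.-‿cong (evaluate-linComb′ a)))
        (SR.-‿inverseʳ (combination a))))
      where
      coeffs = coefficients (component m f) (All-component m f)
      a = proj₁ coeffs
      expand : SE.evaluate f (branch n) S.≈ₛ combination a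
      expand = SR.trans (SE.evaluate-cong (branch n) {f} {component m f} (homogeneous-component {f = f} hom))
        (proj₂ coeffs S.commutativeRing S.constant S.constant-homo (branch n) (branch-onCurve n))
      difference-homogeneous : Homogeneous m (f -ₚ linComb a b)
      difference-homogeneous e e≢m = F.trans (coeff-++ f _ e) (F.trans (F.+-cong (hom e e≢m)
        (F.trans (coeff-neg (linComb a b) e) (F.-‿cong (All⇒Homogeneous {m = m} {f = linComb a b} (All-linComb a) e e≢m))))
        (F.-‿inverseʳ F.0#))

  curve : IrreducibleCurve
  curve = record
    { n                  = suc n
    ; ideal              = ideal
    ; isHomogeneousPrime = isHomogeneousPrime
    ; degree             = q ℕ.^ n
    ; degree>0           = ℕ.m^n>0 q n
    ; hilbertPolynomial  = polynomial
    }
    where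
    polynomial : ∃₂ λ (c : ℤ) m₀ → ∀ m → m₀ ℕ.≤ m → ∃ λ k →
                 HilbertFunction ideal m k × + k ≡ + (q ℕ.^ n) ℤ.* + m ℤ.+ c
    polynomial with length-normals n
    -- `basis m` counts sums below `suc m`, so its length is `d * (m + 1) - T`, with constant term
    -- `d - T`.
    ... | T , t₀ , h = + d ℤ.- + T , t₀ , λ m t₀≤m → length (Basis.exponents m) , hilbertFunction m ,
      solveFor m (length (Basis.exponents m)) (≡.trans (≡.cong (ℕ._+ T) (length-basis {n} m)) (h (suc m) (ℕ.m≤n⇒m≤1+n t₀≤m)))
      where
      d = q ℕ.^ n
      solveFor : ∀ m k → k ℕ.+ T ≡ d ℕ.* suc m → + k ≡ + d ℤ.* + m ℤ.+ (+ d ℤ.- + T)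
      solveFor m k eq = begin
        + k                                ≡⟨ ℤ.+-identityʳ (+ k) ⟨
        + k ℤ.+ + 0                        ≡⟨ ≡.cong (λ x → + k ℤ.+ x) (ℤ.+-inverseʳ (+ T)) ⟨
        + k ℤ.+ (+ T ℤ.- + T)              ≡⟨ ℤ.+-assoc (+ k) (+ T) (ℤ.- + T) ⟨
        + (k ℕ.+ T) ℤ.- + T                ≡⟨ ≡.cong (λ x → + x ℤ.- + T) (≡.trans eq (≡.trans (ℕ.*-suc d m) (ℕ.+-comm d (d ℕ.* m)))) ⟩
        + (d ℕ.* m) ℤ.+ + d ℤ.- + T        ≡⟨ ≡.cong (λ x → x ℤ.+ + d ℤ.- + T) (ℤ.pos-* d m) ⟩
        + d ℤ.* + m ℤ.+ + d ℤ.- + T        ≡⟨ ℤ.+-assoc (+ d ℤ.* + m) (+ d) (ℤ.- + T) ⟩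
        + d ℤ.* + m ℤ.+ (+ d ℤ.- + T)      ∎
        where open ≡.≡-Reasoning

  -- Points over F as solutions of the equations.

  private
    module FE = Evaluation F.commutativeRing id (Identity.isRingHomomorphism F.rawRing F.refl)

    eval≈evaluate : ∀ (f : Poly v) x → eval f x F.≈ FE.evaluate f x
    eval≈evaluate []      x = F.refl
    eval≈evaluate (t ∷ f) x = F.+-congˡ (eval≈evaluate f x)

  -- Vanishing on the branch makes the coefficients of the normal form zero, and these same
  -- coefficients compute the value at `x`.
  ideal-vanishes : ∀ x → OnCurve F.commutativeRing x → ∀ f → ideal f → eval f x F.≈ F.0#
  ideal-vanishes x on f f∈I = F.trans (eval≈evaluate f x) (FE.evaluate-vanish-components x f vanishes)
    where
    vanishes : ∀ m → FE.evaluate (component m f) x F.≈ F.0#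
    vanishes m = F.trans
      (proj₂ coeffs F.commutativeRing id (Identity.isRingHomomorphism F.rawRing F.refl) x on)
      (combination-zero F.commutativeRing id (Identity.isRingHomomorphism F.rawRing F.refl) x
        (independent (proj₁ coeffs) (SR.trans
          (SR.sym (proj₂ coeffs S.commutativeRing S.constant S.constant-homo (branch n) (branch-onCurve n)))
          (f∈I m))))
      where
      open Basis m
      coeffs = coefficients (component m f) (All-component m f)

  private
    module _ (j : Fin n) where

      y y′ last : Fin v
      y    = inject₁ (suc j)
      y′   = suc (suc j)
      last = fromℕ (suc n)

      equation : Poly v
      equation = (F.1# , single y q)
               ∷ (F.- F.1# , single y 1 ⊕ single last p)
               ∷ (F.- F.1# , single zero p ⊕ single y′ 1)
               ∷ []

      All-equation : All (λ t → Vec.sum (proj₂ t) ≡ q) equation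
      All-equation = sum-single y q
        ∷ ≡.trans (sum-⊕ (single y 1) (single last p)) (≡.cong₂ ℕ._+_ (sum-single y 1) (sum-single last p))
        ∷ ≡.trans (sum-⊕ (single {v} zero p) (single y′ 1))
            (≡.trans (≡.cong₂ ℕ._+_ (sum-single {v} zero p) (sum-single y′ 1)) (ℕ.+-comm p 1))
        ∷ []

      module _ (A : CommutativeRing 0ℓ 0ℓ) (ι : F.Carrier → CommutativeRing.Carrier A)
               (ι-homo : IsRingHomomorphism F.rawRing (CommutativeRing.rawRing A) ι) where
        open CommutativeRing A hiding (zero)
        open Monomial A hiding (monomial; monomial-⊕; monomial-single)
        open Evaluation A ι ι-homo
        open IsRingHomomorphism ι-homo using (1#-homo; -‿homo)
        open RingProperties ring using (-1*x≈-x; -‿+-comm)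

        evaluate-equation : ∀ x → evaluate equation x ≈ x y ^ q + - (x y * x last ^ p + x zero ^ p * x y′)
        evaluate-equation x = +-cong
          (trans (*-cong 1#-homo (monomial-single A x y q)) (*-identityˡ _))
          (trans (+-cong
            (negated (trans (monomial-⊕ A x (single y 1) (single last p))
                            (*-cong (trans (monomial-single A x y 1) (*-identityʳ _)) (monomial-single A x last p))))
            (trans (+-identityʳ _)
            (negated (trans (monomial-⊕ A x (single zero p) (single y′ 1))
                            (*-cong (monomial-single A x zero p) (trans (monomial-single A x y′ 1) (*-identityʳ _)))))))
            (-‿+-comm _ _))
          where
          negated : ∀ {a b} → a ≈ b → ι (F.- F.1#) * a ≈ - b
          negated {a} {b} a≈b = trans (*-cong (trans (-‿homo F.1#) (-‿cong 1#-homo)) a≈b) (-1*x≈-x b)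

  open GroupProperties F.+-group using (x∙y⁻¹≈ε⇒x≈y)

  points-onCurve : ∀ x → (∀ f → ideal f → eval f x F.≈ F.0#) → OnCurve F.commutativeRing x
  points-onCurve x vanishes j = x∙y⁻¹≈ε⇒x≈y _ _ (F.trans
    (F.sym (evaluate-equation j F.commutativeRing id (Identity.isRingHomomorphism F.rawRing F.refl) x))
    (F.trans (F.sym (eval≈evaluate (equation j) x)) (vanishes (equation j) equation∈I)))
    where
    equation∈I : ideal (equation j)
    equation∈I = evaluates-to-zero {q} {equation j} (All⇒Homogeneous {m = q} {f = equation j} (All-equation j))
      (SR.trans (evaluate-equation j S.commutativeRing S.constant S.constant-homo (branch n))
        (SR.trans (SR.+-congʳ (branch-onCurve n j)) (SR.-‿inverseʳ _)))

-- Finite fields: decidable equality and `a^q = a`.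

module FiniteField (F : Field) (p : ℕ) (enumeration : HasCardinality (Field.setoid F) (suc p)) where

  open Field F hiding (zero)
  open FieldProperties F using (*-nonzero)
  open Exp semiring using (_^_)
  open Bijection enumeration public using () renaming (to to element; injective to element-injective)
  private
    module E = Bijection enumeration
    module ∏ = CommutativeMonoidSum *-commutativeMonoid
    open SetoidReasoning setoid

  index : Carrier → Fin (suc p)
  index x = proj₁ (E.strictlySurjective x)

  element-index : ∀ x → element (index x) ≈ x
  element-index x = proj₂ (E.strictlySurjective x)

  index-cong : ∀ {x y} → x ≈ y → index x ≡ index y
  index-cong {x} {y} x≈y = element-injective (trans (element-index x) (trans x≈y (sym (element-index y))))

  index-element : ∀ i → index (element i) ≡ i
  index-element i = element-injective (element-index (element i))

  infix 4 _≟_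

  _≟_ : Decidable _≈_
  x ≟ y = map′ (λ eq → trans (sym (element-index x)) (trans (E.cong eq) (element-index y))) index-cong
               (index x Fin.≟ index y)

  private
    -- With 0 replaced by 1, the product of the nonzero elements can be taken over the whole
    -- enumeration.
    unit : Carrier → Carrier
    unit x with x ≟ 0#
    ... | yes _ = 1#
    ... | no  _ = x

    unit-nonzero : ∀ x → ¬ (unit x ≈ 0#)
    unit-nonzero x with x ≟ 0#
    ... | yes _   = 1≉0
    ... | no  x≉0 = x≉0

    unit-cong : ∀ {x y} → x ≈ y → unit x ≈ unit y
    unit-cong {x} {y} x≈y with x ≟ 0# | y ≟ 0#
    ... | yes _   | yes _   = refl
    ... | yes x≈0 | no  y≉0 = contradiction (trans (sym x≈y) x≈0) y≉0
    ... | no  x≉0 | yes y≈0 = contradiction (trans x≈y y≈0) x≉0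
    ... | no  _   | no  _   = x≈y

    ∏-nonzero : ∀ {k} (t : Fin k → Carrier) → (∀ i → ¬ (t i ≈ 0#)) → ¬ (∏.sum t ≈ 0#)
    ∏-nonzero {zero}  t h = 1≉0
    ∏-nonzero {suc k} t h = *-nonzero (h zero) (∏-nonzero (t ∘ suc) (h ∘ suc))

  *-cancelʳ : ∀ {x y z} → ¬ (z ≈ 0#) → x * z ≈ y * z → x ≈ y
  *-cancelʳ {x} {y} {z} z≉0 eq with inverse z z≉0
  ... | z⁻¹ , zz⁻¹≈1 = trans (expand x) (trans (*-congʳ eq) (sym (expand y)))
    where
    expand : ∀ w → w ≈ w * z * z⁻¹
    expand w = sym (trans (*-assoc w z z⁻¹) (trans (*-congˡ zz⁻¹≈1) (*-identityʳ w)))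

  module _ (a : Carrier) (a≉0 : ¬ (a ≈ 0#)) where

    private
      a⁻¹ = proj₁ (inverse a a≉0)

      aa⁻¹≈1 : a * a⁻¹ ≈ 1#
      aa⁻¹≈1 = proj₂ (inverse a a≉0)

      scaling : Permutation (suc p) (suc p)
      scaling = permutation (λ i → index (a * element i)) (λ i → index (a⁻¹ * element i))
        (λ i → undo a a⁻¹ aa⁻¹≈1 i) (λ i → undo a⁻¹ a (trans (*-comm a⁻¹ a) aa⁻¹≈1) i)
        where
        undo : ∀ b c → b * c ≈ 1# → ∀ i → index (b * element (index (c * element i))) ≡ i
        undo b c bc≈1 i = ≡.trans (index-cong (begin
          b * element (index (c * element i)) ≈⟨ *-congˡ (element-index _) ⟩
          b * (c * element i)                 ≈⟨ *-assoc b c _ ⟨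
          b * c * element i                   ≈⟨ *-congʳ bc≈1 ⟩
          1# * element i                      ≈⟨ *-identityˡ _ ⟩
          element i                           ∎)) (index-element i)

      factor : Fin (suc p) → Carrier
      factor i with element i ≟ 0#
      ... | yes _ = 1#
      ... | no  _ = a

      unit-scaled : ∀ i → unit (element (index (a * element i))) ≈ factor i * unit (element i)
      unit-scaled i = trans (unit-cong (element-index _)) scaled
        where
        scaled : unit (a * element i) ≈ factor i * unit (element i)
        scaled with element i ≟ 0# | a * element i ≟ 0#
        ... | yes _   | yes _    = sym (*-identityˡ 1#)
        ... | yes e≈0 | no  ae≉0 = contradiction (trans (*-congˡ e≈0) (zeroʳ a)) ae≉0
        ... | no  e≉0 | yes ae≈0 = contradiction ae≈0 (*-nonzero a≉0 e≉0)
        ... | no  _   | no  _    = refl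

      ∏-units : Carrier
      ∏-units = ∏.sum (unit ∘ element)

      -- Multiplication by `a` permutes the field and so preserves the product of the units, while
      -- it multiplies each of them by its `factor`.
      ∏-factor≈1 : ∏.sum factor ≈ 1#
      ∏-factor≈1 = *-cancelʳ (∏-nonzero (unit ∘ element) (unit-nonzero ∘ element)) (begin
        ∏.sum factor * ∏-units                              ≈⟨ ∏.∑-distrib-+ factor (unit ∘ element) ⟨
        ∏.sum (λ i → factor i * unit (element i))           ≈⟨ ∏.sum-cong-≋ unit-scaled ⟨
        ∏.sum (λ i → unit (element (index (a * element i)))) ≈⟨ ∏.sum-permute (unit ∘ element) scaling ⟨
        ∏-units                                             ≈⟨ *-identityˡ _ ⟨
        1# * ∏-units                                        ∎)

      factor-zero : factor (index 0#) ≈ 1#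
      factor-zero with element (index 0#) ≟ 0#
      ... | yes _   = refl
      ... | no  e≉0 = contradiction (element-index 0#) e≉0

      factor-nonzero : ∀ i → i ≢ index 0# → factor i ≈ a
      factor-nonzero i i≢ with element i ≟ 0#
      ... | yes e≈0 = contradiction (≡.trans (≡.sym (index-element i)) (index-cong e≈0)) i≢
      ... | no  _   = refl

      ∏-all : ∀ {k} (t : Fin k → Carrier) → (∀ i → t i ≈ a) → ∏.sum t ≈ a ^ k
      ∏-all {zero}  t h = refl
      ∏-all {suc k} t h = *-cong (h zero) (∏-all (t ∘ suc) (h ∘ suc))

      -- The extra `a` takes the place of the entry 1, which avoids an exponent `k - 1`.
      ∏-but-one : ∀ {k} (t : Fin k → Carrier) i → t i ≈ 1# → (∀ j → j ≢ i → t j ≈ a) → a * ∏.sum t ≈ a ^ k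
      ∏-but-one t zero    ti≈1 h = *-congˡ (trans (*-cong ti≈1 (∏-all (t ∘ suc) (λ j → h (suc j) λ ()))) (*-identityˡ _))
      ∏-but-one t (suc i) ti≈1 h = *-congˡ (trans (*-congʳ (h zero λ ()))
        (∏-but-one (t ∘ suc) i ti≈1 (λ j j≢i → h (suc j) (j≢i ∘ Fin.suc-injective))))

    fermat-nonzero : a ^ suc p ≈ a
    fermat-nonzero = trans (sym (∏-but-one factor (index 0#) factor-zero factor-nonzero))
                           (trans (*-congˡ ∏-factor≈1) (*-identityʳ a))

  fermat : ∀ a → a ^ suc p ≈ a
  fermat a with a ≟ 0#
  ... | yes a≈0 = trans (trans (*-congʳ a≈0) (zeroˡ _)) (sym a≈0)
  ... | no  a≉0 = fermat-nonzero a a≉0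

  ^-nonzero : ∀ {x} k → ¬ (x ≈ 0#) → ¬ (x ^ k ≈ 0#)
  ^-nonzero zero    x≉0 = 1≉0
  ^-nonzero (suc k) x≉0 = *-nonzero x≉0 (^-nonzero k x≉0)

  ^≈0⇒≈0 : ∀ {x} k → x ^ k ≈ 0# → x ≈ 0#
  ^≈0⇒≈0 {x} k x^k≈0 with x ≟ 0#
  ... | yes x≈0 = x≈0
  ... | no  x≉0 = contradiction x^k≈0 (^-nonzero k x≉0)

  0^ : ∀ {x} k → 0 ℕ.< k → x ≈ 0# → x ^ k ≈ 0#
  0^ (suc k) _ x≈0 = trans (*-congʳ x≈0) (zeroˡ _)

-- Classification and number of the rational points.

module RationalPoints (F : Field) (p : ℕ) (0<p : 0 ℕ.< p)
                      (enumeration : HasCardinality (Field.setoid F) (suc p)) (N : ℕ) where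

  open Field F hiding (zero)
  open FiniteField F p enumeration
  open FieldProperties F using (*-nonzero)
  open Monomial commutativeRing using (_^_; ^-congˡ; 1^)
  open GroupProperties +-group using (∙-cancelˡ)

  private
    n q : ℕ
    -- At least one equation is required: without any the curve is the projective line, which has
    -- rational points of neither kind below.
    n = suc N
    q = suc p

  open TowerCurve F _≟_ p 0<p n using (curve; ideal-vanishes; points-onCurve)
  open Normalisation p using (OnCurve)
  open Curves F using (RationalPoint; _∼_; points)
  open RationalPoint

  private
    Coordinates : Set
    Coordinates = Fin (suc (suc n)) → Carrier

    _,1 : ∀ {k} → (Fin k → Carrier) → Fin (suc k) → Carrier
    _,1 {zero}  g zero    = 1#
    _,1 {suc k} g zero    = g zero
    _,1 {suc k} g (suc i) = ((g ∘ suc) ,1) i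

    ,1-inject₁ : ∀ {k} (g : Fin k → Carrier) j → (g ,1) (inject₁ j) ≡ g j
    ,1-inject₁ {suc k} g zero    = ≡.refl
    ,1-inject₁ {suc k} g (suc j) = ,1-inject₁ (g ∘ suc) j

    ,1-last : ∀ {k} (g : Fin k → Carrier) → (g ,1) (fromℕ k) ≡ 1#
    ,1-last {zero}  g = ≡.refl
    ,1-last {suc k} g = ,1-last (g ∘ suc)

    ramified : Coordinates
    ramified zero    = 1#
    ramified (suc i) = 0#

    ramified-onCurve : OnCurve commutativeRing ramified
    ramified-onCurve j = trans (zeroˡ _) (sym (trans (+-cong (zeroˡ _) (zeroʳ _)) (+-identityˡ 0#)))

    split : (Fin n → Fin q) → Coordinates
    split g zero    = 0#
    split g (suc i) = ((element ∘ g) ,1) i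

    split-onCurve : ∀ g → OnCurve commutativeRing (split g)
    split-onCurve g j = trans (fermat y) (sym (begin
      y * v ^ p + 0# ^ p * y′  ≈⟨ +-cong (*-congˡ (trans (^-congˡ p (reflexive (,1-last (element ∘ g)))) (1^ p)))
                                         (trans (*-congʳ (0^ p 0<p refl)) (zeroˡ _)) ⟩
      y * 1# + 0#              ≈⟨ trans (+-identityʳ _) (*-identityʳ y) ⟩
      y                        ∎))
      where
      open SetoidReasoning setoid
      y  = split g (inject₁ (suc j))
      y′ = split g (suc (suc j))
      v  = split g (fromℕ (suc n))

    point : (x : Coordinates) → OnCurve commutativeRing x → (∃ λ i → ¬ (x i ≈ 0#)) → RationalPoint curve
    point x on x≉0 = record { coord = x ; nonzero = x≉0 ; vanishes = ideal-vanishes x on }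

    ramifiedPoint : RationalPoint curve
    ramifiedPoint = point ramified ramified-onCurve (zero , 1≉0)

    splitPoint : (Fin n → Fin q) → RationalPoint curve
    splitPoint g = point (split g) (split-onCurve g)
      (fromℕ (suc n) , λ eq → 1≉0 (trans (sym (reflexive (,1-last (element ∘ g)))) eq))

    nth : Fin (suc (q ℕ.^ n)) → RationalPoint curve
    nth zero    = ramifiedPoint
    nth (suc i) = splitPoint (finToFun i)

    funToFin-cong : ∀ {k l} {f g : Fin k → Fin l} → (∀ i → f i ≡ g i) → funToFin f ≡ funToFin g
    funToFin-cong {zero}  f≗g = ≡.refl
    funToFin-cong {suc k} f≗g = ≡.cong₂ combine (f≗g zero) (funToFin-cong (f≗g ∘ suc))

    split-injective : ∀ g h → _∼_ curve (splitPoint g) (splitPoint h) → ∀ j → g j ≡ h j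
    split-injective g h (s , s≉0 , g≈sh) j = element-injective (begin
      element (g j)          ≡⟨ ,1-inject₁ (element ∘ g) j ⟨
      split g (suc (inject₁ j)) ≈⟨ g≈sh (suc (inject₁ j)) ⟩
      s * split h (suc (inject₁ j)) ≈⟨ *-cong s≈1 (reflexive (,1-inject₁ (element ∘ h) j)) ⟩
      1# * element (h j)     ≈⟨ *-identityˡ _ ⟩
      element (h j)          ∎)
      where
      open SetoidReasoning setoid
      s≈1 : s ≈ 1#
      s≈1 = begin
        s                            ≈⟨ *-identityʳ s ⟨
        s * 1#                       ≡⟨ ≡.cong (s *_) (,1-last (element ∘ h)) ⟨
        s * split h (fromℕ (suc n))  ≈⟨ g≈sh (fromℕ (suc n)) ⟨
        split g (fromℕ (suc n))      ≡⟨ ,1-last (element ∘ g) ⟩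
        1#                           ∎

    nth-injective : ∀ i j → _∼_ curve (nth i) (nth j) → i ≡ j
    nth-injective zero    zero    _ = ≡.refl
    nth-injective zero    (suc j) (s , s≉0 , eq) = contradiction (trans (eq zero) (zeroʳ s)) 1≉0
    nth-injective (suc i) zero    (s , s≉0 , eq) = contradiction (trans (sym (*-identityʳ s)) (sym (eq zero))) s≉0
    nth-injective (suc i) (suc j) i∼j = ≡.cong suc (≡.trans (≡.sym (Fin.funToFin-finToFin {n} i))
      (≡.trans (funToFin-cong (split-injective (finToFun i) (finToFun j) i∼j)) (Fin.funToFin-finToFin {n} j)))

    Proportional : Coordinates → Coordinates → Set
    Proportional x y = ∃ λ s → ¬ (s ≈ 0#) × (∀ i → x i ≈ s * y i)

    -- If the last coordinate is zero, the equations carry zero down from `yⱼ₊₁` to `yⱼ`. If it is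
    -- not, `v^p = 1` and `y^q = y` leave `z^p yⱼ₊₁ = 0`, and the last of these equations, where
    -- `yₙ = v`, forces `z = 0`.
    classify : ∀ x → OnCurve commutativeRing x → (∃ λ i → ¬ (x i ≈ 0#)) →
               Proportional ramified x ⊎ ∃ λ g → Proportional (split g) x
    classify x on (i , xi≉0) = decide (z ≟ 0#) (v ≟ 0#)
      where
      z = x zero
      v = x (fromℕ (suc n))

      unit-inverse : ∀ {s t} → s * t ≈ 1# → ¬ (t ≈ 0#)
      unit-inverse {s} st≈1 t≈0 = 1≉0 (trans (sym st≈1) (trans (*-congˡ t≈0) (zeroʳ s)))

      vanishing : v ≈ 0# → ∀ j → x (suc j) ≈ 0#
      vanishing v≈0 = >-weakInduction (λ j → x (suc j) ≈ 0#) v≈0 λ j y′≈0 → ^≈0⇒≈0 q (trans (on j)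
        (trans (+-cong (trans (*-congˡ (0^ p 0<p v≈0)) (zeroʳ _)) (trans (*-congˡ y′≈0) (zeroʳ _))) (+-identityˡ 0#)))

      all-zero : z ≈ 0# → (∀ j → x (suc j) ≈ 0#) → ∀ i → x i ≈ 0#
      all-zero z≈0 y≈0 zero    = z≈0
      all-zero z≈0 y≈0 (suc j) = y≈0 j

      v^p≈1 : ¬ (v ≈ 0#) → v ^ p ≈ 1#
      v^p≈1 v≉0 = *-cancelʳ v≉0 (trans (*-comm _ v) (trans (fermat v) (sym (*-identityˡ v))))

      z^p*y′≈0 : ¬ (v ≈ 0#) → ∀ j → z ^ p * x (suc (suc j)) ≈ 0#
      z^p*y′≈0 v≉0 j = ∙-cancelˡ y _ _ (begin
        y + z ^ p * x (suc (suc j))         ≈⟨ +-congʳ (trans (*-congˡ (v^p≈1 v≉0)) (*-identityʳ y)) ⟨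
        y * v ^ p + z ^ p * x (suc (suc j)) ≈⟨ on j ⟨
        y ^ q                               ≈⟨ fermat y ⟩
        y                                   ≈⟨ +-identityʳ y ⟨
        y + 0#                              ∎)
        where
        open SetoidReasoning setoid
        y = x (inject₁ (suc j))

      decide : Dec (z ≈ 0#) → Dec (v ≈ 0#) → Proportional ramified x ⊎ ∃ λ g → Proportional (split g) x
      decide (yes z≈0) (yes v≈0) = contradiction (all-zero z≈0 (vanishing v≈0) i) xi≉0
      decide (no z≉0) (yes v≈0) with inverse z z≉0
      ... | z⁻¹ , zz⁻¹≈1 = inj₁ (z⁻¹ , unit-inverse zz⁻¹≈1 , λ
        { zero    → sym (trans (*-comm z⁻¹ z) zz⁻¹≈1)
        ; (suc j) → sym (trans (*-congˡ (vanishing v≈0 j)) (zeroʳ z⁻¹)) })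
      decide (no z≉0) (no v≉0) = contradiction (z^p*y′≈0 v≉0 (fromℕ N)) (*-nonzero (^-nonzero p z≉0) v≉0)
      decide (yes z≈0) (no v≉0) with inverse v v≉0
      ... | v⁻¹ , vv⁻¹≈1 = inj₂ (g , v⁻¹ , unit-inverse vv⁻¹≈1 , λ
        { zero    → sym (trans (*-congˡ z≈0) (zeroʳ v⁻¹))
        -- A case distinction between the last index and those of the form `inject₁ j`.
        ; (suc j) → >-weakInduction (λ j → ((element ∘ g) ,1) j ≈ v⁻¹ * x (suc j))
            (trans (reflexive (,1-last (element ∘ g))) (sym (trans (*-comm v⁻¹ v) vv⁻¹≈1)))
            (λ j _ → trans (reflexive (,1-inject₁ (element ∘ g) j)) (element-index _)) j })
        where
        g : Fin n → Fin q
        g j = index (v⁻¹ * x (suc (inject₁ j)))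

    ,1-cong : ∀ {k} {f h : Fin k → Carrier} → (∀ j → f j ≈ h j) → ∀ j → (f ,1) j ≈ (h ,1) j
    ,1-cong {zero}  f≈h zero    = refl
    ,1-cong {suc k} f≈h zero    = f≈h zero
    ,1-cong {suc k} f≈h (suc j) = ,1-cong (f≈h ∘ suc) j

    split-finToFun : ∀ g i → split (finToFun (funToFin g)) i ≈ split g i
    split-finToFun g zero    = refl
    split-finToFun g (suc j) = ,1-cong (λ j → reflexive (≡.cong element (Fin.finToFun-funToFin g j))) j

    nth-surjective : ∀ P → ∃ λ i → _∼_ curve (nth i) P
    nth-surjective P = locate (classify (coord P) (points-onCurve (coord P) (vanishes P)) (nonzero P))
      where
      locate : Proportional ramified (coord P) ⊎ (∃ λ g → Proportional (split g) (coord P)) → ∃ λ i → _∼_ curve (nth i) P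
      locate (inj₁ (s , s≉0 , eq))     = zero , s , s≉0 , eq
      locate (inj₂ (g , s , s≉0 , eq)) = suc (funToFin g) , s , s≉0 , λ i → trans (split-finToFun g i) (eq i)

  cardinality : HasCardinality (points curve) (suc (q ℕ.^ n))
  cardinality = record
    { to        = nth
    ; cong      = λ { {i} ≡.refl → Points.refl {nth i} }
    ; bijective = (λ {i} {j} → nth-injective i j) , λ P → proj₁ (nth-surjective P) , λ { ≡.refl → proj₂ (nth-surjective P) }
    }
    where
    module Points = Setoid (points curve)

  pointCount : Curves.PointCount F (q ℕ.^ n) (suc (q ℕ.^ n))
  pointCount = curve , ≡.refl , cardinality

-- The limit superior along the degrees `q ^ suc N`.

theorem1p1 : (q : ℕ) → IsPrimePower q → 2 < q →
    (F : Field) → HasCardinality (Field.setoid F) q →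
    fromℚ 1ℚ ≤ᴸ Curves.D F
theorem1p1 q@(suc p) _ (s≤s 1<p) F enumeration c (lift c<1) = e , c<e , λ N →
  -- The curve with `n = suc N` has degree `d` and `d + 1` points, more than `e * d`. The index is
  -- `pred d` because of the shift in `D`, and it exceeds every bound since `n < q ^ n`.
  let d = q ℕ.^ suc N
      suc-pred-d = ℕ.suc-pred d {{ℕ.>-nonZero (ℕ.<-trans (s≤s z≤n) (n<q^n (suc N)))}}
  in ℕ.pred d , ℕ.<⇒≤pred (ℕ.<-trans (ℕ.n<1+n N) (n<q^n (suc N))) , suc d ,
     ≡.subst (λ d′ → Curves.PointCount F d′ (suc d)) (≡.sym suc-pred-d) (RationalPoints.pointCount F p (ℕ.<⇒≤ 1<p) enumeration N) ,
     ≡.subst (λ d′ → e ℚ.* ℕ→ℚ (suc (ℕ.pred d)) ℚ.< ℕ→ℚ (suc d′)) suc-pred-d (below-count (ℕ.pred d))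
  where
  between = ℚ.<-dense c<1
  e   = proj₁ between
  c<e = proj₁ (proj₂ between)
  e<1 = proj₂ (proj₂ between)

  n<q^n : ∀ n → n ℕ.< q ℕ.^ n
  n<q^n zero    = s≤s z≤n
  n<q^n (suc n) = ℕ.<-≤-trans (s≤s (n<q^n n)) (ℕ.≤-trans
    (ℕ.+-monoˡ-≤ (q ℕ.^ n) (ℕ.≤-trans (s≤s z≤n) (n<q^n n)))
    (ℕ.≤-trans (ℕ.≤-reflexive (≡.cong (q ℕ.^ n ℕ.+_) (≡.sym (ℕ.+-identityʳ _)))) (ℕ.*-monoˡ-≤ (q ℕ.^ n) (s≤s (ℕ.<⇒≤ 1<p)))))

  below-count : ∀ d → e ℚ.* ℕ→ℚ (suc d) ℚ.< ℕ→ℚ (suc (suc d))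
  below-count d = begin-strict
    e ℚ.* ℕ→ℚ (suc d)   <⟨ ℚ.*-monoˡ-<-pos (ℕ→ℚ (suc d)) e<1 ⟩
    1ℚ ℚ.* ℕ→ℚ (suc d)  ≡⟨ ℚ.*-identityˡ _ ⟩
    ℕ→ℚ (suc d)         ≤⟨ ℚ.*≤* (ℤ.*-monoʳ-≤-nonNeg (+ 1) (ℤ.+≤+ (ℕ.n≤1+n (suc d)))) ⟩
    ℕ→ℚ (suc (suc d))   ∎
    where open ℚ.≤-Reasoning
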